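{- Every outer $2$-planar graph has treewidth at most $4$, and this bound is tight: there is an outer $2$-planar graph with treewidth exactly $4$.
   Context: A convex drawing of a finite simple graph $G$ places the vertices of $G$ at distinct points of a circle and draws every edge as a straight-line segment. A convex drawing is outer $k$-planar if every edge crosses at most $k$ other edges. A graph is outer $k$-planar if it admits an outer $k$-planar drawing. -}

module Defs where

open import Data.Nat using (ℕ; zero; suc; _≤_; _<_; _<ᵇ_; _≡ᵇ_; _⊔_; _⊓_)
open import Data.Bool using (Bool; true; false; T; _∧_; _xor_; not; if_then_else_)
open import Data.Fin using (Fin; toℕ)
open import Data.Fin.Subset using (Subset; _∈_; ∣_∣)
open import Data.List using (List; []; _∷_; _∷ʳ_; length; map; allFin)
open import Data.Nat.ListAction using (sum)
open import Data.List.Relation.Unary.Linked using (Linked)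
open import Data.List.Relation.Unary.Unique.Propositional using (Unique)
open import Data.Product using (Σ; _×_; ∃)
open import Data.Unit using (⊤)
open import Relation.Binary.PropositionalEquality using (_≡_)
open import Relation.Nullary using (¬_)
open import Function.Definitions using (Injective)

record SimpleGraph (n : ℕ) : Set where
  field
    Adj    : Fin n → Fin n → Bool
    sym    : ∀ x y → Adj x y ≡ Adj y x
    irrefl : ∀ x → Adj x x ≡ false

  Edge : Fin n → Fin n → Set
  Edge x y = T (Adj x y)

open SimpleGraph public

-- Convex drawings.
-- Vertices are placed at distinct points of a circle; only the cyclic
-- order of these points matters for which straight-line chords cross.
-- We record the drawing as the (injective) position of each vertex in
-- the order around the circle.

record ConvexDrawing (n : ℕ) : Set where
  field
    pos    : Fin n → Fin n
    pos-inj : Injective _≡_ _≡_ pos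

open ConvexDrawing public

module _ {n : ℕ} (D : ConvexDrawing n) where
  private
    p : Fin n → ℕ
    p v = toℕ (pos D v)

  -- c lies strictly on the arc from a to b not containing the point 0,
  -- i.e. strictly between a and b in the linear order of positions
  between : Fin n → Fin n → Fin n → Bool
  between a b c = ((p a ⊓ p b) <ᵇ p c) ∧ (p c <ᵇ (p a ⊔ p b))

  distinct : Fin n → Fin n → Bool
  distinct u v = not (p u ≡ᵇ p v)

  crossesB : Fin n → Fin n → Fin n → Fin n → Bool
  crossesB a b c d =
    distinct a b ∧ distinct a c ∧ distinct a d ∧
    distinct b c ∧ distinct b d ∧ distinct c d ∧
    (between a b c xor between a b d)

crossCount : ∀ {n} → SimpleGraph n → ConvexDrawing n → Fin n → Fin n → ℕ
crossCount {n} G D a b =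
  sum (map (λ c → sum (map (λ d →
         if (toℕ c <ᵇ toℕ d) ∧ Adj G c d ∧ crossesB D a b c d then 1 else 0)
       (allFin n))) (allFin n))

IsOuterKPlanarDrawing : ℕ → ∀ {n} → SimpleGraph n → ConvexDrawing n → Set
IsOuterKPlanarDrawing k G D = ∀ a b → Edge G a b → crossCount G D a b ≤ k

OuterKPlanar : ℕ → ∀ {n} → SimpleGraph n → Set
OuterKPlanar k {n} G = Σ (ConvexDrawing n) λ D → IsOuterKPlanarDrawing k G D

data Walk {m : ℕ} (G : SimpleGraph m) (P : Fin m → Set) : Fin m → Fin m → Set where
  here : ∀ {x} → P x → Walk G P x x
  step : ∀ {x y z} → P x → Edge G x y → Walk G P y z → Walk G P x z

Connected : ∀ {m} → SimpleGraph m → Set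
Connected G = ∀ x y → Walk G (λ _ → ⊤) x y

HasCycle : ∀ {m} → SimpleGraph m → Set
HasCycle {m} G =
  Σ (Fin m) λ x → Σ (List (Fin m)) λ zs → Σ (Fin m) λ y →
    1 ≤ length zs ×
    Unique (x ∷ zs ∷ʳ y) ×
    Linked (Edge G) (x ∷ zs ∷ʳ y) ×
    Edge G y x

IsTree : ∀ {m} → SimpleGraph m → Set
IsTree {m} T = 1 ≤ m × Connected T × ¬ HasCycle T

record TreeDecomposition {n : ℕ} (G : SimpleGraph n) : Set where
  field
    m        : ℕ
    tree     : SimpleGraph m
    isTree   : IsTree tree
    bag      : Fin m → Subset n
    cover-v  : ∀ v → Σ (Fin m) λ t → v ∈ bag t
    cover-e  : ∀ u v → Edge G u v → Σ (Fin m) λ t → u ∈ bag t × v ∈ bag t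
    coherent : ∀ v t t′ → v ∈ bag t → v ∈ bag t′ →
               Walk tree (λ s → v ∈ bag s) t t′

open TreeDecomposition public

WidthAtMost : ℕ → ∀ {n} {G : SimpleGraph n} → TreeDecomposition G → Set
WidthAtMost k TD = ∀ t → ∣ bag TD t ∣ ≤ suc k

TreewidthAtMost : ℕ → ∀ {n} → SimpleGraph n → Set
TreewidthAtMost k G = Σ (TreeDecomposition G) λ TD → WidthAtMost k TD

TreewidthExactly : ℕ → ∀ {n} → SimpleGraph n → Set
TreewidthExactly k G = TreewidthAtMost k G × (∀ j → j < k → ¬ TreewidthAtMost j G)

{-# OPTIONS --safe #-}
module Submission where

-- Upper bound. A chord ab of the circle is treated when at most two vertices y, z strictly between
-- a and b have neighbours outside, and at most one edge other than ab passes over each of y and z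
-- inside [a, b]. The part of the graph on [a, b] is then decomposed with {a, b, y, z} in a bag.
-- If y ≤ z has such a neighbour x, let lm be the edge over y: the bag {a, b, y, z, m} separates the
-- chord ay (with l as its only vertex with outside neighbours) from the chord yb (with z and m),
-- and over l and over m there is at most one further edge since lm is already crossed by xy.
-- If there is no such y, let c be the farthest neighbour of a before b: at most two edges l₁m₁ and
-- l₂m₂ pass over c, because they cross ac, and the bag {a, b, c, m₁, m₂} separates ac (with l₁ and
-- l₂) from cb (with m₁ and m₂).
-- Tightness. K₅ drawn as a pentagon is outer 2-planar, and a clique lies in a single bag.

open import Defs hiding (sym)
open import Data.Bool using (Bool; true; false; T; not; T?; _∧_; _xor_; if_then_else_)
import Data.Bool.Properties as Bool
open import Data.Empty using (⊥; ⊥-elim)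
open import Data.Fin as Fin using (Fin; zero; suc; toℕ; fromℕ<)
import Data.Fin.Properties as Fin
open import Data.Fin.Subset as Subset using (Subset; ∣_∣; ⁅_⁆; _∪_)
import Data.Fin.Subset.Properties as Subset
open import Data.List using (List; []; _∷_; _∷ʳ_; _++_; length; map; allFin; cartesianProduct)
open import Data.List.Membership.Propositional using (_∈_; _∉_)
open import Data.List.Membership.Propositional.Properties using (∈-allFin; ∈-cartesianProduct⁺)
open import Data.List.Properties using (length-map; map-++; map-∘)
open import Data.List.Relation.Unary.All as All using (All; []; _∷_)
open import Data.List.Relation.Unary.All.Properties using (∷ʳ⁻; ¬Any⇒All¬)
open import Data.List.Relation.Unary.AllPairs using ([]; _∷_)
open import Data.List.Relation.Unary.Any using (here; there)
open import Data.List.Relation.Unary.Linked using (Linked; [-]; _∷_)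
import Data.List.Relation.Unary.Linked.Properties as Linked
open import Data.List.Relation.Unary.Unique.Propositional using (Unique)
import Data.List.Relation.Unary.Unique.Propositional.Properties as Unique
open import Data.Nat
open import Data.Nat.ListAction using (sum)
open import Data.Nat.ListAction.Properties using (sum-++)
open import Data.Nat.Properties
open import Data.Product using (Σ; ∃; ∃₂; _×_; _,_; proj₁; proj₂; uncurry)
open import Data.Product.Properties using (≡-dec)
open import Data.Sum using (_⊎_; inj₁; inj₂; [_,_]′; swap)
open import Data.Unit using (tt)
open import Data.Vec using ([]; _∷_)
open import Function using (_∘_; id; Equivalence)
open import Relation.Binary.Definitions using (tri<; tri≈; tri>)
open import Relation.Binary.PropositionalEquality
  using (_≡_; _≢_; refl; sym; trans; cong; cong₂; subst; ≢-sym; module ≡-Reasoning)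
open import Relation.Nullary using (¬_; Dec; yes; no; contradiction)
open import Relation.Nullary.Decidable
  using (_×-dec_; _→-dec_; ¬?; map′; ⌊_⌋; toWitness; fromWitness; from-yes)
open import Relation.Unary using (Decidable)

open import Data.List.Membership.DecPropositional _≟_ using (_∈?_)

-- Edges over a chord

Inside Outside : ℕ → ℕ → ℕ → Set
Inside a b v = a < v × v < b
Outside a b x = x < a ⊎ b < x

data Position (a b x : ℕ) : Set where
  outside : Outside a b x → Position a b x
  left    : x ≡ a → Position a b x
  right   : x ≡ b → Position a b x
  inside  : Inside a b x → Position a b x

position : ∀ a b x → Position a b x
position a b x with <-cmp x a | <-cmp x b
... | tri< x<a _ _ | _            = outside (inj₁ x<a)
... | tri≈ _ x≡a _ | _            = left x≡a
... | tri> _ _ a<x | tri< x<b _ _ = inside (a<x , x<b)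
... | tri> _ _ _   | tri≈ _ x≡b _ = right x≡b
... | tri> _ _ _   | tri> _ _ b<x = outside (inj₂ b<x)

greatest : ∀ {P : ℕ → Set} → Decidable P → ∀ n →
           (∃ λ c → c < n × P c × (∀ {d} → c < d → d < n → ¬ P d)) ⊎
           (∀ {d} → d < n → ¬ P d)
greatest P? zero = inj₂ λ ()
greatest P? (suc n) with P? n
... | yes Pn = inj₁ (n , ≤-refl , Pn , λ n<d d<1+n → contradiction n<d (≤⇒≯ (s≤s⁻¹ d<1+n)))
... | no ¬Pn with greatest P? n
...   | inj₁ (c , c<n , Pc , above) = inj₁ (c , m<n⇒m<1+n c<n , Pc , above′)
  where
  above′ : ∀ {d} → c < d → d < suc n → ¬ _
  above′ c<d d<1+n with m<1+n⇒m<n∨m≡n d<1+n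
  ... | inj₁ d<n  = above c<d d<n
  ... | inj₂ refl = ¬Pn
...   | inj₂ none = inj₂ none′
  where
  none′ : ∀ {d} → d < suc n → ¬ _
  none′ d<1+n with m<1+n⇒m<n∨m≡n d<1+n
  ... | inj₁ d<n  = none d<n
  ... | inj₂ refl = ¬Pn

_≟²_ : (q r : ℕ × ℕ) → Dec (q ≡ r)
_≟²_ = ≡-dec _≟_ _≟_

search² : ∀ {P : ℕ × ℕ → Set} → Decidable P → ∀ n → (∀ {l m} → P (l , m) → l < n × m < n) →
          Dec (∃ P)
search² P? n bound = map′
  (λ (l , _ , m , _ , Plm) → (l , m) , Plm)
  (λ ((l , m) , Plm) → l , proj₁ (bound Plm) , m , proj₂ (bound Plm) , Plm)
  (anyUpTo? (λ l → anyUpTo? (λ m → P? (l , m)) n) n)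

-- Build E S a b: a tree decomposition of width 4 that has S in one of its bags and no other
-- vertex strictly between a and b can be extended by these vertices and their edges.
data Build (E : ℕ → ℕ → Set) : List ℕ → ℕ → ℕ → Set where
  stop  : ∀ {S a b} → (∀ {v} → Inside a b v → v ∈ S) → Build E S a b
  -- The last premise excludes edges to vertices already forgotten. An edge to a vertex still to
  -- come is covered when that vertex enters.
  intro : ∀ {S a b} v → Inside a b v → v ∉ S → length S ≤ 4 →
          (∀ {u} → E v u → Inside a b u ⊎ u ∈ S) →
          Build E (v ∷ S) a b → Build E S a b
  -- A vertex strictly inside the interval must stay, since it may still have uncovered edges and
  -- may not enter a second time.
  drop  : ∀ {S S′ a b} → All (_∈ S) S′ → All (λ v → Inside a b v → v ∈ S′) S →
          Build E S′ a b → Build E S a b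
  split : ∀ {S a b} c → Inside a b c → c ∈ S →
          Build E S a c → Build E S c b → Build E S a b

Crosses : (ℕ → ℕ → Set) → ℕ → ℕ → ℕ × ℕ → Set
Crosses E v w (p , q) =
  E p q × p < q × (Inside p q v × Outside p q w ⊎ Inside p q w × Outside p q v)

module Sweep
  (E : ℕ → ℕ → Set) (E? : ∀ i j → Dec (E i j)) (E-sym : ∀ {i j} → E i j → E j i)
  (sparse : ∀ {v w q₁ q₂ q₃} → E v w →
            Crosses E v w q₁ → Crosses E v w q₂ → Crosses E v w q₃ →
            q₁ ≡ q₂ ⊎ q₁ ≡ q₃ ⊎ q₂ ≡ q₃)
  where

  Crosses-swap : ∀ {v w q} → Crosses E v w q → Crosses E w v q
  Crosses-swap (e , p<q , inj₁ x) = e , p<q , inj₂ x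
  Crosses-swap (e , p<q , inj₂ x) = e , p<q , inj₁ x

  -- The vertices named in a bag may coincide with each other or with an end of the interval. One
  -- that is already present needs no new bag.
  introduce : ∀ {S a b} v → v ∈ S ⊎ Inside a b v × (∀ {u} → E v u → Inside a b u ⊎ u ∈ S) →
              length S ≤ 4 → Build E (v ∷ S) a b → Build E S a b
  introduce {S} v why ≤4 B with v ∈? S
  ... | yes v∈S = drop (v∈S ∷ All.tabulate (λ x → x)) (All.tabulate (λ x _ → there x)) B
  ... | no v∉S with why
  ...   | inj₁ v∈S = contradiction v∈S v∉S
  ...   | inj₂ (in-v , nbrs) = intro v in-v v∉S ≤4 nbrs B

  record Over (a b y : ℕ) (q : ℕ × ℕ) : Set where
    constructor over
    field
      a≤l  : a ≤ proj₁ q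
      l<y  : proj₁ q < y
      y<m  : y < proj₂ q
      m≤b  : proj₂ q ≤ b
      edge : E (proj₁ q) (proj₂ q)
      ≢ab  : q ≢ (a , b)

  over? : ∀ a b y → Decidable (Over a b y)
  over? a b y (l , m) = map′
    (λ (h₁ , h₂ , h₃ , h₄ , h₅ , h₆) → over h₁ h₂ h₃ h₄ h₅ h₆)
    (λ (over h₁ h₂ h₃ h₄ h₅ h₆) → h₁ , h₂ , h₃ , h₄ , h₅ , h₆)
    ((a ≤? l) ×-dec (l <? y) ×-dec (y <? m) ×-dec (m ≤? b) ×-dec E? l m
      ×-dec ¬? ((l , m) ≟² (a , b)))

  over-bound : ∀ {a b y l m} → Over a b y (l , m) → l < suc b × m < suc b
  over-bound (over _ l<y y<m m≤b _ _) = m<n⇒m<1+n (<-≤-trans (<-trans l<y y<m) m≤b) , s≤s m≤b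

  Solitary : ℕ → ℕ → ℕ → Set
  Solitary a b y = ∀ {q r} → Over a b y q → Over a b y r → q ≡ r

  -- The pair (a , b) stands for an absent edge.
  Candidate : ℕ → ℕ → ℕ → ℕ × ℕ → Set
  Candidate a b y q = q ≡ (a , b) ⊎ Over a b y q

  module Candidates {a b y} (iy : Inside a b y) where
    cand-left : ∀ {l m} → Candidate a b y (l , m) → a ≡ l ⊎ Inside a y l
    cand-left (inj₁ refl) = inj₁ refl
    cand-left (inj₂ o) with m≤n⇒m<n∨m≡n (Over.a≤l o)
    ... | inj₁ a<l = inj₂ (a<l , Over.l<y o)
    ... | inj₂ a≡l = inj₁ a≡l

    cand-right : ∀ {l m} → Candidate a b y (l , m) → m ≡ b ⊎ Inside y b m
    cand-right (inj₁ refl) = inj₁ refl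
    cand-right (inj₂ o) with m≤n⇒m<n∨m≡n (Over.m≤b o)
    ... | inj₁ m<b = inj₂ (Over.y<m o , m<b)
    ... | inj₂ m≡b = inj₁ m≡b

    cand-l<y : ∀ {l m} → Candidate a b y (l , m) → l < y
    cand-l<y (inj₁ refl) = proj₁ iy
    cand-l<y (inj₂ o) = Over.l<y o

    cand-y<m : ∀ {l m} → Candidate a b y (l , m) → y < m
    cand-y<m (inj₁ refl) = proj₂ iy
    cand-y<m (inj₂ o) = Over.y<m o

    -- An end strictly inside the interval rules out the placeholder.
    cand-over : ∀ {l m} → Candidate a b y (l , m) → a < l ⊎ m < b → Over a b y (l , m)
    cand-over (inj₁ refl) (inj₁ a<a) = contradiction a<a (<-irrefl refl)
    cand-over (inj₁ refl) (inj₂ b<b) = contradiction b<b (<-irrefl refl)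
    cand-over (inj₂ o) _ = o

  solitary-edge : ∀ {a b y} → Solitary a b y →
                  ∃ λ q → Candidate a b y q × (∀ {r} → Over a b y r → r ≡ q)
  solitary-edge {a} {b} {y} sol with search² (over? a b y) (suc b) over-bound
  ... | yes (q , o) = q , inj₂ o , λ o′ → sol o′ o
  ... | no none = (a , b) , inj₁ refl , λ o → contradiction (_ , o) none

  double-edge : ∀ {a b y} →
    (∀ {q r s} → Over a b y q → Over a b y r → Over a b y s → q ≡ r ⊎ q ≡ s ⊎ r ≡ s) →
    ∃₂ λ q r → Candidate a b y q × Candidate a b y r × (∀ {s} → Over a b y s → s ≡ q ⊎ s ≡ r)
  double-edge {a} {b} {y} ≤2 with search² (over? a b y) (suc b) over-bound
  ... | no none = (a , b) , (a , b) , inj₁ refl , inj₁ refl , λ o → contradiction (_ , o) none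
  ... | yes (q , oq) with search² (λ r → over? a b y r ×-dec ¬? (r ≟² q)) (suc b) (over-bound ∘ proj₁)
  ...   | no none = q , q , inj₂ oq , inj₂ oq , single
    where
    single : ∀ {s} → Over a b y s → s ≡ q ⊎ s ≡ q
    single {s} os with s ≟² q
    ... | yes s≡q = inj₁ s≡q
    ... | no s≢q = contradiction (s , os , s≢q) none
  ...   | yes (r , or , r≢q) = q , r , inj₂ oq , inj₂ or , both
    where
    both : ∀ {s} → Over a b y s → s ≡ q ⊎ s ≡ r
    both os with ≤2 oq or os
    ... | inj₁ q≡r = contradiction (sym q≡r) r≢q
    ... | inj₂ (inj₁ q≡s) = inj₁ (sym q≡s)
    ... | inj₂ (inj₂ r≡s) = inj₂ (sym r≡s)

  -- Together with g, two edges over v would be three crossings of vw.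
  solitary : ∀ {a b v w g} → E v w → Outside a b w → Crosses E v w g →
             (∀ {q} → Over a b v q → q ≢ g) → Solitary a b v
  solitary {a} {b} {v} {w} e out-w crosses-g ≢g oq or
    with sparse e (crosses oq) (crosses or) crosses-g
    where
    crosses : ∀ {q} → Over a b v q → Crosses E v w q
    crosses (over a≤l l<v v<m m≤b lm _) =
      lm , <-trans l<v v<m ,
      inj₁ ((l<v , v<m) ,
            [ (λ w<a → inj₁ (<-≤-trans w<a a≤l)) , (λ b<w → inj₂ (≤-<-trans m≤b b<w)) ]′ out-w)
  ... | inj₁ q≡r = q≡r
  ... | inj₂ (inj₁ q≡g) = contradiction q≡g (≢g oq)
  ... | inj₂ (inj₂ r≡g) = contradiction r≡g (≢g or)

  -- The outside neighbour `x` is recorded because the edge `yx` crosses every edge over `y` and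
  -- thus uses up one of its two crossings.
  record Exit (a b y : ℕ) : Set where
    constructor exit
    field
      in-y  : Inside a b y
      x     : ℕ
      out-x : Outside a b x
      edge  : E y x
      sol   : Solitary a b y

  -- The end points a and b are admitted as dummies, so that fewer than two exits need no
  -- separate treatment.
  Marked : ℕ → ℕ → ℕ → Set
  Marked a b y = a ≡ y ⊎ y ≡ b ⊎ Exit a b y

  marked-≥ : ∀ {a b y} → a ≤ b → Marked a b y → a ≤ y
  marked-≥ _   (inj₁ refl)        = ≤-refl
  marked-≥ a≤b (inj₂ (inj₁ refl)) = a≤b
  marked-≥ _   (inj₂ (inj₂ ex))   = <⇒≤ (proj₁ (Exit.in-y ex))

  OnlyExits : ℕ → ℕ → ℕ → ℕ → Set
  OnlyExits a b y z = ∀ {v x} → Inside a b v → Outside a b x → E v x → v ≡ y ⊎ v ≡ z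

  -- The number `k` bounds `b - a` and drives the induction. A cut at an interior vertex lowers it
  -- on both sides.
  Buildable : ℕ → Set
  Buildable k = ∀ {a b y z} → b ≤ k + a → Marked a b y → Marked a b z → OnlyExits a b y z →
           Build E (a ∷ b ∷ y ∷ z ∷ []) a b

  pattern #0 = here refl
  pattern #1 = there (here refl)
  pattern #2 = there (there (here refl))
  pattern #3 = there (there (there (here refl)))
  pattern #4 = there (there (there (there (here refl))))

  not-first : ∀ {a b} {A : Set} → Inside a b a → A
  not-first (a<a , _) = contradiction a<a (<-irrefl refl)

  not-last : ∀ {a b} {A : Set} → Inside a b b → A
  not-last (_ , b<b) = contradiction b<b (<-irrefl refl)

  -- Splitting an interval into two shorter ones

  fuel-left : ∀ {k a b c} → b ≤ suc k + a → c < b → c ≤ k + a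
  fuel-left b≤ c<b = s≤s⁻¹ (≤-trans c<b b≤)

  fuel-right : ∀ {k a b c} → b ≤ suc k + a → a < c → b ≤ k + c
  fuel-right {k} {a} b≤ a<c = ≤-trans (≤-trans b≤ (≤-reflexive (sym (+-suc k a)))) (+-monoʳ-≤ k a<c)

  -- The cut is made at `y`. As `Marked y b z` puts `z` at or right of `y`, no vertex strictly
  -- between `a` and `y` has a neighbour outside [a, b].
  atExit : ∀ {k a b y z} → Buildable k → b ≤ suc k + a → Exit a b y → Marked y b z →
           OnlyExits a b y z → Build E (a ∷ b ∷ y ∷ z ∷ []) a b
  atExit {k} {a} {b} {y} {z} buildable b≤ (exit iy@(a<y , y<b) x out-x yx sol) marked-z only
    with solitary-edge sol
  ... | (l , m) , cand , unique =
    introduce m m-ok (s≤s (s≤s (s≤s (s≤s z≤n))))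
      (split y iy #3
        (drop (#0 ∷ #1 ∷ #3 ∷ [])
              ((λ (_ , m<y) → contradiction m<y (<-asym y<m)) ∷ not-first ∷
               (λ (_ , b<y) → contradiction b<y (<-asym y<b)) ∷ not-last ∷
               (λ (_ , z<y) → contradiction z<y (≤⇒≯ y≤z)) ∷ [])
          -- On the left `m` is kept until `l` has entered, since at most the edge `lm` joins the
          -- inside of [a, y] to its outside.
          (introduce l l-ok (s≤s (s≤s (s≤s z≤n)))
            (drop (#2 ∷ #3 ∷ #0 ∷ #0 ∷ [])
                  ((λ _ → #2) ∷ (λ (_ , m<y) → contradiction m<y (<-asym y<m)) ∷
                   (λ _ → #0) ∷ (λ _ → #1) ∷ [])
              (buildable (fuel-left {k} b≤ y<b) marked-l marked-l only-l))))
        (drop (#3 ∷ #2 ∷ #4 ∷ #0 ∷ [])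
              ((λ _ → #3) ∷ (λ (y<a , _) → contradiction y<a (<-asym a<y)) ∷ (λ _ → #1) ∷
               (λ _ → #0) ∷ (λ _ → #2) ∷ [])
          (buildable (fuel-right b≤ a<y) marked-z marked-m only-r)))
    where
    open Candidates iy

    l<y : l < y
    l<y = cand-l<y cand
    y<m : y < m
    y<m = cand-y<m cand

    y≤z : y ≤ z
    y≤z = marked-≥ (<⇒≤ y<b) marked-z

    m-ok : m ∈ a ∷ b ∷ y ∷ z ∷ [] ⊎
           Inside a b m × (∀ {u} → E m u → Inside a b u ⊎ u ∈ a ∷ b ∷ y ∷ z ∷ [])
    m-ok with m ≟ z
    ... | yes refl = inj₁ #3
    ... | no m≢z with cand-right cand
    ...   | inj₁ refl = inj₁ #1
    ...   | inj₂ (y<m , m<b) = inj₂ ((<-trans a<y y<m , m<b) , nbrs)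
      where
      nbrs : ∀ {u} → E m u → Inside a b u ⊎ u ∈ a ∷ b ∷ y ∷ z ∷ []
      nbrs {u} mu with position a b u
      ... | left refl = inj₂ #0
      ... | right refl = inj₂ #1
      ... | inside iu = inj₁ iu
      -- Being right of `y` and different from `z`, the vertex `m` is neither of the two that may
      -- have outside neighbours.
      ... | outside ou with only (<-trans a<y y<m , m<b) ou mu
      ...   | inj₁ refl = contradiction y<m (<-irrefl refl)
      ...   | inj₂ m≡z = contradiction m≡z m≢z

    -- A vertex left of `y` has no neighbour outside [a, b], so the edge passes over `y`. It starts
    -- strictly after `a` and hence is not `ab`.
    cross-left : ∀ {v u} → Inside a y v → Outside a y u → E v u → (v , u) ≡ (l , m)
    cross-left {v} {u} (a<v , v<y) ou vu with position a b u
    cross-left (a<v , v<y) ou vu | outside out with only (a<v , <-trans v<y y<b) out vu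
    ... | inj₁ refl = contradiction v<y (<-irrefl refl)
    ... | inj₂ refl = contradiction v<y (≤⇒≯ y≤z)
    cross-left (a<v , v<y) (inj₁ u<a) vu | left refl = contradiction u<a (<-irrefl refl)
    cross-left (a<v , v<y) (inj₂ y<u) vu | left refl = contradiction y<u (<-asym a<y)
    cross-left (a<v , v<y) ou vu | right refl =
      unique (over (<⇒≤ a<v) v<y y<b ≤-refl vu λ { refl → <-irrefl refl a<v })
    cross-left (a<v , v<y) (inj₁ u<a) vu | inside (a<u , u<b) = contradiction u<a (<-asym a<u)
    cross-left (a<v , v<y) (inj₂ y<u) vu | inside (a<u , u<b) =
      unique (over (<⇒≤ a<v) v<y y<u (<⇒≤ u<b) vu λ { refl → <-irrefl refl a<v })

    l-ok : l ∈ m ∷ a ∷ y ∷ [] ⊎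
           Inside a y l × (∀ {u} → E l u → Inside a y u ⊎ u ∈ m ∷ a ∷ y ∷ [])
    l-ok with cand-left cand
    ... | inj₁ refl = inj₁ #1
    ... | inj₂ il = inj₂ (il , nbrs)
      where
      nbrs : ∀ {u} → E l u → Inside a y u ⊎ u ∈ m ∷ a ∷ y ∷ []
      nbrs {u} lu with position a y u
      ... | left refl = inj₂ #1
      ... | right refl = inj₂ #2
      ... | inside iu = inj₁ iu
      ... | outside ou with cross-left il ou lu
      ...   | refl = inj₂ #0

    only-l : OnlyExits a y l l
    only-l iv ou vu = inj₁ (cong proj₁ (cross-left iv ou vu))

    -- Such an edge either leaves [a, b], and then starts at `z`, or it passes over `y`, and then it
    -- is `lm`.
    only-r : OnlyExits y b z m
    only-r {v} {u} (y<v , v<b) ou vu with position a b u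
    only-r (y<v , v<b) ou vu | outside out with only (<-trans a<y y<v , v<b) out vu
    ... | inj₁ refl = contradiction y<v (<-irrefl refl)
    ... | inj₂ v≡z = inj₁ v≡z
    only-r (y<v , v<b) ou vu | left refl =
      inj₂ (cong proj₂ (unique (over ≤-refl a<y y<v (<⇒≤ v<b) (E-sym vu)
        λ { refl → <-irrefl refl v<b })))
    only-r (y<v , v<b) (inj₁ b<y) vu | right refl = contradiction b<y (<-asym y<b)
    only-r (y<v , v<b) (inj₂ b<b) vu | right refl = contradiction b<b (<-irrefl refl)
    only-r (y<v , v<b) (inj₁ u<y) vu | inside (a<u , _) =
      inj₂ (cong proj₂ (unique (over (<⇒≤ a<u) u<y y<v (<⇒≤ v<b) (E-sym vu)
        λ { refl → <-irrefl refl v<b })))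
    only-r (y<v , v<b) (inj₂ b<u) vu | inside (_ , u<b) = contradiction b<u (<-asym u<b)

    -- The crossing edge joins `y`, strictly between `l` and `m`, to `x`. Its end outside [a, b]
    -- distinguishes it from all edges within [a, b].
    guard : Over a b y (l , m) →
            ∃ λ g → Crosses E l m g × (∀ {q} → a ≤ proj₁ q → proj₂ q ≤ b → q ≢ g)
    guard (over a≤l _ _ m≤b _ _) = [ onLeft , onRight ]′ out-x
      where
      onLeft : x < a → _
      onLeft x<a =
        (x , y) ,
        (E-sym yx , <-trans x<a a<y , inj₁ ((<-≤-trans x<a a≤l , l<y) , inj₂ y<m)) ,
        λ { a≤x _ refl → contradiction x<a (≤⇒≯ a≤x) }
      onRight : b < x → _
      onRight b<x =
        (y , x) ,
        (yx , <-trans y<b b<x , inj₂ ((y<m , ≤-<-trans m≤b b<x) , inj₁ l<y)) ,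
        λ { _ x≤b refl → contradiction b<x (≤⇒≯ x≤b) }

    -- The edge `xy` is the extra crossing of `lm` that leaves room for only one edge over `l` in
    -- [a, y].
    marked-l : Marked a y l
    marked-l with cand-left cand
    ... | inj₁ a≡l = inj₁ a≡l
    ... | inj₂ il with cand-over cand (inj₁ (proj₁ il))
    ...   | o with guard o
    ...     | g , crosses , distinct =
      inj₂ (inj₂ (exit il m (inj₂ y<m) (Over.edge o) (solitary (Over.edge o) (inj₂ y<m) crosses
        λ oq → distinct (Over.a≤l oq) (≤-trans (Over.m≤b oq) (<⇒≤ y<b)))))

    marked-m : Marked y b m
    marked-m with cand-right cand
    ... | inj₁ m≡b = inj₂ (inj₁ m≡b)
    ... | inj₂ im with cand-over cand (inj₂ (proj₂ im))
    ...   | o with guard o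
    ...     | g , crosses , distinct =
      inj₂ (inj₂ (exit im l (inj₁ l<y) ml (solitary ml (inj₁ l<y) (Crosses-swap crosses)
        λ oq → distinct (≤-trans (<⇒≤ a<y) (Over.a≤l oq)) (Over.m≤b oq))))
      where
      ml : E m l
      ml = E-sym (Over.edge o)

  -- The cut is made at the last neighbour of `a` before `b`, or at `a + 1` if there is none.
  noExit : ∀ {k a b} → Buildable k → b ≤ suc k + a →
           (∀ {v x} → Inside a b v → Outside a b x → E v x → ⊥) →
           Build E (a ∷ b ∷ []) a b
  noExit {k} {a} {b} buildable b≤ closed
    with greatest (λ c → (a <? c) ×-dec E? a c) b
  ... | inj₂ none with suc a <? b
  ...   | no ≮b = stop λ (a<v , v<b) → contradiction (≤-<-trans a<v v<b) ≮b
  -- With no neighbour strictly inside, `a` can be forgotten once `a + 1` has entered. No edge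
  -- leaves the inside of [a + 1, b], so both marks are dummies.
  ...   | yes c<b =
    introduce (suc a) (inj₂ ((≤-refl , c<b) , neighbours (≤-refl , c<b))) (s≤s (s≤s z≤n))
      (split (suc a) (≤-refl , c<b) #0
        (stop λ (a<v , v≤a) → contradiction a<v (≤⇒≯ (s≤s⁻¹ v≤a)))
        (drop (#0 ∷ #2 ∷ #0 ∷ #0 ∷ [])
              ((λ _ → #0) ∷ (λ (c<a , _) → contradiction c<a (<-asym ≤-refl)) ∷ (λ _ → #1) ∷ [])
          (buildable (fuel-right b≤ ≤-refl) (inj₁ refl) (inj₁ refl) only)))
    where
    neighbours : ∀ {v u} → Inside a b v → E v u → Inside a b u ⊎ u ∈ a ∷ b ∷ []
    neighbours {u = u} iv vu with position a b u
    ... | left refl  = inj₂ #0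
    ... | right refl = inj₂ #1
    ... | inside iu  = inj₁ iu
    ... | outside ou = ⊥-elim (closed iv ou vu)

    only : OnlyExits (suc a) b (suc a) (suc a)
    only {v} {u} (c<v , v<b) ou vu with neighbours (<-trans ≤-refl c<v , v<b) vu
    ... | inj₂ #0 = contradiction (<-trans ≤-refl c<v , E-sym vu) (none v<b)
    only (c<v , v<b) (inj₁ b<c) vu | inj₂ #1 = contradiction b<c (<-asym c<b)
    only (c<v , v<b) (inj₂ b<b) vu | inj₂ #1 = contradiction b<b (<-irrefl refl)
    only (c<v , v<b) (inj₁ u<c) vu | inj₁ (a<u , _) = contradiction u<c (≤⇒≯ a<u)
    only (c<v , v<b) (inj₂ b<u) vu | inj₁ (_ , u<b) = contradiction b<u (<-asym u<b)
  noExit {k} {a} {b} buildable b≤ closed | inj₁ (c , c<b , (a<c , ac) , farthest) = main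
    where
    ic : Inside a b c
    ic = a<c , c<b

    open Candidates ic

    neighbours : ∀ {S v u} → a ∈ S → b ∈ S → Inside a b v → E v u → Inside a b u ⊎ u ∈ S
    neighbours {u = u} a∈ b∈ iv vu with position a b u
    ... | left refl  = inj₂ a∈
    ... | right refl = inj₂ b∈
    ... | inside iu  = inj₁ iu
    ... | outside ou = ⊥-elim (closed iv ou vu)

    -- An edge over `c` that starts at `a` would lead to a later neighbour of `a` before `b`, or be
    -- `ab` itself.
    over-a< : ∀ {l m} → Over a b c (l , m) → a < l
    over-a< (over a≤l l<c c<m m≤b lm ≢ab) with m≤n⇒m<n∨m≡n a≤l | m≤n⇒m<n∨m≡n m≤b
    ... | inj₁ a<l  | _         = a<l
    ... | inj₂ refl | inj₁ m<b  = contradiction (<-trans a<c c<m , lm) (farthest c<m m<b)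
    ... | inj₂ refl | inj₂ refl = contradiction refl ≢ab

    crosses-ac : ∀ {q} → Over a b c q → Crosses E a c q
    crosses-ac o@(over _ l<c c<m _ lm _) =
      lm , <-trans l<c c<m , inj₂ ((l<c , c<m) , inj₁ (over-a< o))

    main : Build E (a ∷ b ∷ []) a b
    main with double-edge (λ o₁ o₂ o₃ → sparse ac (crosses-ac o₁) (crosses-ac o₂) (crosses-ac o₃))
    ... | (l₁ , m₁) , (l₂ , m₂) , cand₁ , cand₂ , all-over =
      introduce c (inj₂ (ic , neighbours #0 #1 ic)) (s≤s (s≤s z≤n))
        (introduce m₁ (m-ok #1 #2 cand₁) (s≤s (s≤s (s≤s z≤n)))
          (introduce m₂ (m-ok #2 #3 cand₂) (s≤s (s≤s (s≤s (s≤s z≤n))))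
            (split c ic #2
              -- Here `b` leaves the bag: an edge to it from left of `c` passes over `c`, and then
              -- `b` is `m₁` or `m₂`.
              (drop (#1 ∷ #0 ∷ #3 ∷ #2 ∷ [])
                    (m-out cand₂ ∷ m-out cand₁ ∷ not-last ∷ not-first ∷
                     (λ (_ , b<c) → contradiction b<c (<-asym c<b)) ∷ [])
                (introduce l₁ l₁-ok (s≤s (s≤s (s≤s (s≤s z≤n))))
                  -- The bag now has five places, so `m₁` must go before `l₂` enters. If `l₂`
                  -- differs from `l₁`, its only possible neighbour outside [a, c] is `m₂`;
                  -- otherwise it is already present.
                  (drop (#0 ∷ #2 ∷ #3 ∷ #4 ∷ [])
                        ((λ _ → #0) ∷ m-out cand₁ ∷ m-out cand₂ ∷ (λ _ → #2) ∷ (λ _ → #3) ∷ [])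
                    (introduce l₂ l₂-ok (s≤s (s≤s (s≤s (s≤s z≤n))))
                      (drop (#3 ∷ #4 ∷ #1 ∷ #0 ∷ [])
                            ((λ _ → #3) ∷ (λ _ → #2) ∷ m-out cand₂ ∷ (λ _ → #0) ∷ (λ _ → #1) ∷ [])
                        (buildable (fuel-left {k} b≤ c<b) (marked-l cand₁) (marked-l cand₂) only-l))))))
              (drop (#2 ∷ #4 ∷ #1 ∷ #0 ∷ [])
                    ((λ _ → #3) ∷ (λ _ → #2) ∷ not-first ∷
                     (λ (c<a , _) → contradiction c<a (<-asym a<c)) ∷ not-last ∷ [])
                (buildable (fuel-right b≤ a<c) (marked-m cand₁) (marked-m cand₂) only-r)))))
      where
      m-ok : ∀ {S l m} → a ∈ S → b ∈ S → Candidate a b c (l , m) →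
             m ∈ S ⊎ Inside a b m × (∀ {u} → E m u → Inside a b u ⊎ u ∈ S)
      m-ok a∈ b∈ cand with cand-right cand
      ... | inj₁ refl        = inj₁ b∈
      ... | inj₂ (c<m , m<b) =
        inj₂ ((<-trans a<c c<m , m<b) , neighbours a∈ b∈ (<-trans a<c c<m , m<b))

      m-out : ∀ {l m} {A : Set} → Candidate a b c (l , m) → Inside a c m → A
      m-out cand (_ , m<c) = contradiction m<c (<-asym (cand-y<m cand))

      cross-left : ∀ {v u} → Inside a c v → Outside a c u → E v u →
                   (v , u) ≡ (l₁ , m₁) ⊎ (v , u) ≡ (l₂ , m₂)
      cross-left {v} {u} (a<v , v<c) ou vu
        with neighbours {S = a ∷ b ∷ []} #0 #1 (a<v , <-trans v<c c<b) vu
      cross-left (a<v , v<c) (inj₁ a<a) vu | inj₂ #0 = contradiction a<a (<-irrefl refl)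
      cross-left (a<v , v<c) (inj₂ c<a) vu | inj₂ #0 = contradiction c<a (<-asym a<c)
      cross-left (a<v , v<c) ou vu | inj₂ #1 =
        all-over (over (<⇒≤ a<v) v<c c<b ≤-refl vu λ { refl → <-irrefl refl a<v })
      cross-left (a<v , v<c) (inj₁ u<a) vu | inj₁ (a<u , _) = contradiction u<a (<-asym a<u)
      cross-left (a<v , v<c) (inj₂ c<u) vu | inj₁ (_ , u<b) =
        all-over (over (<⇒≤ a<v) v<c c<u (<⇒≤ u<b) vu λ { refl → <-irrefl refl a<v })

      only-l : OnlyExits a c l₁ l₂
      only-l iv ou vu with cross-left iv ou vu
      ... | inj₁ refl = inj₁ refl
      ... | inj₂ refl = inj₂ refl

      l₁-ok : l₁ ∈ m₁ ∷ m₂ ∷ a ∷ c ∷ [] ⊎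
              Inside a c l₁ × (∀ {u} → E l₁ u → Inside a c u ⊎ u ∈ m₁ ∷ m₂ ∷ a ∷ c ∷ [])
      l₁-ok with cand-left cand₁
      ... | inj₁ refl = inj₁ #2
      ... | inj₂ il = inj₂ (il , nbrs)
        where
        nbrs : ∀ {u} → E l₁ u → Inside a c u ⊎ u ∈ m₁ ∷ m₂ ∷ a ∷ c ∷ []
        nbrs {u} lu with position a c u
        ... | left refl  = inj₂ #2
        ... | right refl = inj₂ #3
        ... | inside iu  = inj₁ iu
        ... | outside ou with cross-left il ou lu
        ...   | inj₁ refl = inj₂ #0
        -- This is the case of a common left end of the two edges, which is why `m₂` is also
        -- required when `l₁` enters.
        ...   | inj₂ refl = inj₂ #1

      l₂-ok : l₂ ∈ l₁ ∷ m₂ ∷ a ∷ c ∷ [] ⊎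
              Inside a c l₂ × (∀ {u} → E l₂ u → Inside a c u ⊎ u ∈ l₁ ∷ m₂ ∷ a ∷ c ∷ [])
      l₂-ok with l₂ ≟ l₁ | cand-left cand₂
      ... | yes refl | _ = inj₁ #0
      ... | no _ | inj₁ refl = inj₁ #2
      ... | no l₂≢l₁ | inj₂ il = inj₂ (il , nbrs)
        where
        nbrs : ∀ {u} → E l₂ u → Inside a c u ⊎ u ∈ l₁ ∷ m₂ ∷ a ∷ c ∷ []
        nbrs {u} lu with position a c u
        ... | left refl  = inj₂ #2
        ... | right refl = inj₂ #3
        ... | inside iu  = inj₁ iu
        ... | outside ou with cross-left il ou lu
        ...   | inj₁ refl = contradiction refl l₂≢l₁
        ...   | inj₂ refl = inj₂ #1

      -- By the choice of `c` no vertex strictly between `c` and `b` is adjacent to `a`. Any edge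
      -- leaving this side therefore passes over `c`.
      only-r : OnlyExits c b m₁ m₂
      only-r {v} {u} (c<v , v<b) ou vu
        with neighbours {S = a ∷ b ∷ []} #0 #1 (<-trans a<c c<v , v<b) vu
      only-r (c<v , v<b) _ vu | inj₂ #0 =
        contradiction (<-trans a<c c<v , E-sym vu) (farthest c<v v<b)
      only-r (c<v , v<b) (inj₁ b<c) vu | inj₂ #1 = contradiction b<c (<-asym c<b)
      only-r (c<v , v<b) (inj₂ b<b) vu | inj₂ #1 = contradiction b<b (<-irrefl refl)
      only-r (c<v , v<b) (inj₂ b<u) vu | inj₁ (_ , u<b) = contradiction b<u (<-asym u<b)
      only-r (c<v , v<b) (inj₁ u<c) vu | inj₁ (a<u , _)
        with all-over (over (<⇒≤ a<u) u<c c<v (<⇒≤ v<b) (E-sym vu) λ { refl → <-irrefl refl v<b })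
      ... | inj₁ refl = inj₁ refl
      ... | inj₂ refl = inj₂ refl

      -- The extra crossing of `lm` is the edge `ac`, which is itself not counted among the edges
      -- over `l` in [a, c].
      marked-l : ∀ {l m} → Candidate a b c (l , m) → Marked a c l
      marked-l {l} {m} cand with cand-left cand
      ... | inj₁ a≡l = inj₁ a≡l
      ... | inj₂ il@(a<l , l<c) = inj₂ (inj₂ (exit il m (inj₂ c<m) lm (solitary lm (inj₂ c<m)
          (ac , a<c , inj₁ (il , inj₂ c<m)) Over.≢ab)))
        where
        c<m : c < m
        c<m = cand-y<m cand
        lm : E l m
        lm = Over.edge (cand-over cand (inj₁ a<l))

      -- Again `ac` crosses `lm`. It starts before `c`, so it differs from the edges over `m` in
      -- [c, b].
      marked-m : ∀ {l m} → Candidate a b c (l , m) → Marked c b m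
      marked-m {l} {m} cand with cand-right cand
      ... | inj₁ m≡b = inj₂ (inj₁ m≡b)
      ... | inj₂ im@(c<m , m<b) with cand-over cand (inj₂ m<b)
      ...   | o@(over _ l<c _ _ lm _) = inj₂ (inj₂ (exit im l (inj₁ l<c) (E-sym lm)
          (solitary (E-sym lm) (inj₁ l<c) (ac , a<c , inj₂ ((over-a< o , l<c) , inj₂ c<m))
            λ { oq refl → contradiction a<c (≤⇒≯ (Over.a≤l oq)) })))

  -- Order of the exits, dummies, and the induction

  swap-exits : ∀ {a b y z} → Build E (a ∷ b ∷ z ∷ y ∷ []) a b → Build E (a ∷ b ∷ y ∷ z ∷ []) a b
  swap-exits = drop (#0 ∷ #1 ∷ #3 ∷ #2 ∷ []) ((λ _ → #0) ∷ (λ _ → #1) ∷ (λ _ → #3) ∷ (λ _ → #2) ∷ [])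

  -- A neighbour outside [a, b] is outside [y, b] too. An edge over `z` in [y, b] starts after `a`,
  -- so it is not `ab` and was counted before.
  restrict : ∀ {a b y z} → Exit a b y → Exit a b z → y ≤ z → Marked y b z
  restrict (exit (a<y , _) _ _ _ _) (exit (_ , z<b) x out-x e sol) y≤z with m≤n⇒m<n∨m≡n y≤z
  ... | inj₂ y≡z = inj₁ y≡z
  ... | inj₁ y<z = inj₂ (inj₂ (exit (y<z , z<b) x out′ e λ o o′ → sol (widen o) (widen o′)))
    where
    out′ = [ (λ x<a → inj₁ (<-trans x<a a<y)) , inj₂ ]′ out-x
    widen : ∀ {q} → Over _ _ _ q → Over _ _ _ q
    widen (over y≤l l<z z<m m≤b lm _) =
      over (≤-trans (<⇒≤ a<y) y≤l) l<z z<m m≤b lm λ { refl → contradiction a<y (≤⇒≯ y≤l) }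

  Dummy : ℕ → ℕ → ℕ → Set
  Dummy a b y = a ≡ y ⊎ y ≡ b

  marked-cases : ∀ {a b y} → Marked a b y → Dummy a b y ⊎ Exit a b y
  marked-cases (inj₁ a≡y)        = inj₁ (inj₁ a≡y)
  marked-cases (inj₂ (inj₁ y≡b)) = inj₁ (inj₂ y≡b)
  marked-cases (inj₂ (inj₂ ex))  = inj₂ ex

  dummy-∉ : ∀ {a b y} {A : Set} → Dummy a b y → Inside a b y → A
  dummy-∉ (inj₁ refl) = not-first
  dummy-∉ (inj₂ refl) = not-last

  dummy-∈ : ∀ {a b y S} → Dummy a b y → y ∈ a ∷ b ∷ S
  dummy-∈ (inj₁ refl) = #0
  dummy-∈ (inj₂ refl) = #1

  -- The cut at `y` needs the second mark at or right of `y`, so the dummy is replaced by `b`.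
  singleExit : ∀ {k a b y z} → Buildable k → b ≤ suc k + a → Exit a b y → Dummy a b z →
               OnlyExits a b y z → Build E (a ∷ b ∷ y ∷ z ∷ []) a b
  singleExit g b≤ ey dz only =
    drop (#0 ∷ #1 ∷ #2 ∷ #1 ∷ [])
         ((λ _ → #0) ∷ (λ _ → #1) ∷ (λ _ → #2) ∷ (λ _ → dummy-∈ dz) ∷ [])
      (atExit g b≤ ey (inj₂ (inj₁ refl)) λ iv ou vu →
        [ inj₁ , (λ { refl → dummy-∉ dz iv }) ]′ (only iv ou vu))

  buildable : ∀ k → Buildable k
  buildable zero b≤a _ _ _ = stop λ (a<v , v<b) → contradiction (<-trans a<v v<b) (≤⇒≯ b≤a)
  buildable (suc k) {y = y} {z} b≤ my mz only with marked-cases my | marked-cases mz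
  ... | inj₂ ey | inj₁ dz = singleExit (buildable k) b≤ ey dz only
  ... | inj₁ dy | inj₂ ez =
    swap-exits (singleExit (buildable k) b≤ ez dy λ iv ou vu → swap (only iv ou vu))
  ... | inj₁ dy | inj₁ dz =
    drop (#0 ∷ #1 ∷ []) ((λ _ → #0) ∷ (λ _ → #1) ∷ dummy-∉ dy ∷ dummy-∉ dz ∷ [])
      (noExit (buildable k) b≤ λ iv ou vu →
        [ (λ { refl → dummy-∉ dy iv }) , (λ { refl → dummy-∉ dz iv }) ]′ (only iv ou vu))
  ... | inj₂ ey | inj₂ ez with ≤-total y z
  ...   | inj₁ y≤z = atExit (buildable k) b≤ ey (restrict ey ez y≤z) only
  ...   | inj₂ z≤y =
    swap-exits (atExit (buildable k) b≤ ez (restrict ez ey z≤y) λ iv ou vu → swap (only iv ou vu))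

  -- All vertices have positions below `n`. Thus `n` is an artificial right end, and no edge leaves
  -- [0, n].
  build : ∀ n → (∀ {i j} → E i j → i < n) → Build E (0 ∷ n ∷ []) 0 n
  build n bound =
    drop (#0 ∷ #1 ∷ #0 ∷ #0 ∷ []) ((λ _ → #0) ∷ (λ _ → #1) ∷ [])
      (buildable n (m≤m+n n 0) (inj₁ refl) (inj₁ refl)
        λ { _ (inj₂ n<x) e → contradiction (bound (E-sym e)) (<-asym n<x) })

-- Tree decompositions grown leaf by leaf

-- Node zero is the latest leaf.
mutual
  data Decomp : ℕ → Set where
    root : ∀ S → length S ≤ 5 → Decomp 0
    leaf : ∀ {m} (d : Decomp m) (t : Fin (suc m)) S → length S ≤ 5 →
           All (λ v → v ∈ bags d t ⊎ (∀ i → v ∉ bags d i)) S → Decomp (suc m)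

  bags : ∀ {m} → Decomp m → Fin (suc m) → List ℕ
  bags (root S _)         _       = S
  bags (leaf d t S _ _) zero    = S
  bags (leaf d t S _ _) (suc i) = bags d i

bags-length : ∀ {m} (d : Decomp m) i → length (bags d i) ≤ 5
bags-length (root S ≤5) _ = ≤5
bags-length (leaf d t S ≤5 _) zero = ≤5
bags-length (leaf d t S ≤5 _) (suc i) = bags-length d i

tree-adj : ∀ {m} → Decomp m → Fin (suc m) → Fin (suc m) → Bool
tree-adj (root _ _) _ _ = false
tree-adj (leaf d t _ _ _) zero    zero    = false
tree-adj (leaf d t _ _ _) zero    (suc j) = ⌊ j Fin.≟ t ⌋
tree-adj (leaf d t _ _ _) (suc i) zero    = ⌊ i Fin.≟ t ⌋
tree-adj (leaf d t _ _ _) (suc i) (suc j) = tree-adj d i j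

tree-sym : ∀ {m} (d : Decomp m) i j → tree-adj d i j ≡ tree-adj d j i
tree-sym (root _ _) _ _ = refl
tree-sym (leaf d t _ _ _) zero    zero    = refl
tree-sym (leaf d t _ _ _) zero    (suc j) = refl
tree-sym (leaf d t _ _ _) (suc i) zero    = refl
tree-sym (leaf d t _ _ _) (suc i) (suc j) = tree-sym d i j

tree-irrefl : ∀ {m} (d : Decomp m) i → tree-adj d i i ≡ false
tree-irrefl (root _ _) _ = refl
tree-irrefl (leaf d t _ _ _) zero    = refl
tree-irrefl (leaf d t _ _ _) (suc i) = tree-irrefl d i

treeOf : ∀ {m} → Decomp m → SimpleGraph (suc m)
treeOf d = record { Adj = tree-adj d ; sym = tree-sym d ; irrefl = tree-irrefl d }

unsuc : ∀ {n} (zs : List (Fin (suc n))) → All (_≢ zero) zs → ∃ λ zs′ → zs ≡ map Fin.suc zs′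
unsuc [] [] = [] , refl
unsuc (zero ∷ zs) (z≢ ∷ _) = contradiction refl z≢
unsuc (suc z ∷ zs) (_ ∷ zs≢) with unsuc zs zs≢
... | zs′ , refl = z ∷ zs′ , refl

module _ {m} (d : Decomp m) (t : Fin (suc m)) (S : List ℕ) (≤5 : length S ≤ 5)
  (ok : All (λ v → v ∈ bags d t ⊎ (∀ i → v ∉ bags d i)) S) where
  private
    d⁺ = leaf d t S ≤5 ok

  lift-walk : ∀ {P : Fin (suc (suc m)) → Set} {i j} →
              Walk (treeOf d) (P ∘ suc) i j → Walk (treeOf d⁺) P (suc i) (suc j)
  lift-walk (here p)     = here p
  lift-walk (step p e w) = step p e (lift-walk w)

  -- The predicate is arbitrary so that one argument gives both the connectedness of the tree and
  -- the coherence of the bags.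
  extend-walk : ∀ {P : Fin (suc (suc m)) → Set} →
                (∀ i j → P (suc i) → P (suc j) → Walk (treeOf d) (P ∘ suc) i j) →
                (P zero → ∀ j → P (suc j) → P (suc t)) →
                ∀ i j → P i → P j → Walk (treeOf d⁺) P i j
  extend-walk walk attach zero    zero    p q = here p
  extend-walk walk attach zero    (suc j) p q =
    step p (fromWitness refl) (lift-walk (walk t j (attach p j q) q))
  extend-walk {P} walk attach (suc i) zero p q = snoc (lift-walk (walk i t p (attach q i p)))
    where
    snoc : ∀ {k} → Walk (treeOf d⁺) P k (suc t) → Walk (treeOf d⁺) P k zero
    snoc (here r)     = step r (fromWitness refl) (here q)
    snoc (step r e w) = step r e (snoc w)
  extend-walk walk attach (suc i) (suc j) p q = lift-walk (walk i j p q)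

  leaf-neighbour : ∀ {j} → Edge (treeOf d⁺) zero j → j ≡ suc t
  leaf-neighbour {suc j} e = cong suc (toWitness e)

  leaf-neighbour′ : ∀ {j} → Edge (treeOf d⁺) j zero → j ≡ suc t
  leaf-neighbour′ {suc j} e = cong suc (toWitness e)

  -- An interior vertex of a path has two distinct neighbours on it, whereas the leaf is adjacent to
  -- `suc t` only.
  path-avoids-leaf : ∀ x zs y → Linked (Edge (treeOf d⁺)) (x ∷ zs ∷ʳ y) → Unique (x ∷ zs ∷ʳ y) →
                     x ≢ zero → y ≢ zero → All (_≢ zero) zs
  path-avoids-leaf x [] y l u x≢ y≢ = []
  path-avoids-leaf x (zero ∷ []) y (e ∷ e′ ∷ _) ((_ ∷ x≢y ∷ []) ∷ _) x≢ y≢ =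
    contradiction (trans (leaf-neighbour′ {x} e) (sym (leaf-neighbour {y} e′))) x≢y
  path-avoids-leaf x (zero ∷ z ∷ zs) y (e ∷ e′ ∷ _) ((_ ∷ x≢z ∷ _) ∷ _) x≢ y≢ =
    contradiction (trans (leaf-neighbour′ {x} e) (sym (leaf-neighbour {z} e′))) x≢z
  path-avoids-leaf x (suc z ∷ zs) y (_ ∷ l) (_ ∷ u) x≢ y≢ =
    (λ ()) ∷ path-avoids-leaf (suc z) zs y l u (λ ()) y≢

  last-neighbour : ∀ x zs → Linked (Edge (treeOf d⁺)) (x ∷ zs ∷ʳ zero) → 1 ≤ length zs →
                   suc t ∈ zs
  last-neighbour x (z ∷ []) (_ ∷ e ∷ _) _ = here (sym (leaf-neighbour′ {z} e))
  last-neighbour x (z ∷ z′ ∷ zs) (_ ∷ l) _ = there (last-neighbour z (z′ ∷ zs) l (s≤s z≤n))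

  -- If the leaf were the first or the last vertex listed, both cycle edges at it would lead to
  -- `suc t`, which would then be repeated. Otherwise the cycle avoids the leaf and lies in the
  -- smaller tree.
  cycle-down : HasCycle (treeOf d⁺) → HasCycle (treeOf d)
  cycle-down (zero , z ∷ zs , y , _ , (_ ∷ u) , (e ∷ l) , e′)
    with leaf-neighbour {z} e | leaf-neighbour′ {y} e′
  ... | refl | refl with u
  ...   | z≢ ∷ _ = contradiction refl (proj₂ (∷ʳ⁻ z≢))
  cycle-down (suc x , zs , zero , ≥1 , (x≢ ∷ u) , l , e′) with last-neighbour (suc x) zs l ≥1
  ... | t∈zs = contradiction (leaf-neighbour {suc x} e′) (All.lookup (proj₁ (∷ʳ⁻ x≢)) t∈zs)
  cycle-down (suc x , zs , suc y , ≥1 , u , l , e′)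
    with unsuc zs (path-avoids-leaf (suc x) zs (suc y) l u (λ ()) (λ ()))
  ... | zs′ , refl =
    x , zs′ , y , subst (1 ≤_) (length-map suc zs′) ≥1 ,
    Unique.map⁻ (subst Unique shape u) ,
    Linked.map⁻ (subst (Linked (Edge (treeOf d⁺))) shape l) , e′
    where
    shape : suc x ∷ map suc zs′ ∷ʳ suc y ≡ map suc (x ∷ zs′ ∷ʳ y)
    shape = cong (suc x ∷_) (sym (map-++ suc zs′ (y ∷ [])))

-- A vertex of the leaf's bag that occurs in any earlier bag also occurs in the bag of the node to
-- which the leaf is attached.
coherence : ∀ {m} (d : Decomp m) v i j → v ∈ bags d i → v ∈ bags d j →
            Walk (treeOf d) (λ k → v ∈ bags d k) i j
coherence (root S _) v zero zero p q = here p
coherence (leaf d t S ≤5 ok) v = extend-walk d t S ≤5 ok (coherence d v) attach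
  where
  attach : v ∈ S → ∀ j → v ∈ bags d j → v ∈ bags d t
  attach v∈S j v∈j with All.lookup ok v∈S
  ... | inj₁ v∈t   = v∈t
  ... | inj₂ fresh = contradiction v∈j (fresh j)

treeOf-connected : ∀ {m} (d : Decomp m) → Connected (treeOf d)
treeOf-connected (root _ _) zero zero = here tt
treeOf-connected (leaf d t S ≤5 ok) i j =
  extend-walk d t S ≤5 ok (λ i j _ _ → treeOf-connected d i j) (λ _ _ _ → tt) i j tt tt

treeOf-acyclic : ∀ {m} (d : Decomp m) → ¬ HasCycle (treeOf d)
treeOf-acyclic (root _ _) (_ , _ , _ , _ , _ , _ , ())
treeOf-acyclic (leaf d t S ≤5 ok) = treeOf-acyclic d ∘ cycle-down d t S ≤5 ok

treeOf-isTree : ∀ {m} (d : Decomp m) → IsTree (treeOf d)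
treeOf-isTree d = s≤s z≤n , treeOf-connected d , treeOf-acyclic d

-- Realising a build as a tree decomposition

module _ {E : ℕ → ℕ → Set} (E-sym : ∀ {i j} → E i j → E j i) where

  -- The field `new` confines added vertices to the open interval, which keeps the two halves of a
  -- split apart. The field `edge` leaves edges among vertices of `S` to the caller.
  record Extension {m} (d : Decomp m) (S : List ℕ) (a b : ℕ) : Set where
    field
      {size}  : ℕ
      result  : Decomp size
      old     : Fin (suc m) → Fin (suc size)
      old-bag : ∀ i → bags result (old i) ≡ bags d i
      new     : ∀ {v} i → v ∈ bags result i → (∃ λ j → v ∈ bags d j) ⊎ Inside a b v
      vertex  : ∀ {v} → Inside a b v → ∃ λ i → v ∈ bags result i
      edge    : ∀ {v u} → Inside a b v → v ∉ S → E v u →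
                ∃ λ i → v ∈ bags result i × u ∈ bags result i

    old-∈ : ∀ {v} i → v ∈ bags d i → v ∈ bags result (old i)
    old-∈ i = subst (_ ∈_) (sym (old-bag i))

  open Extension

  -- Invariant: `S` is part of the bag of `t`, and interior vertices outside `S` have not occurred
  -- yet. Only `intro` adds a node; `drop` just uses less of the bag of `t`.
  extend : ∀ {S a b} → Build E S a b → ∀ {m} (d : Decomp m) t → All (_∈ bags d t) S →
           (∀ {v} → Inside a b v → v ∉ S → ∀ i → v ∉ bags d i) → Extension d S a b
  extend (stop all∈S) d t S⊆t fresh = record
    { result  = d
    ; old     = λ i → i
    ; old-bag = λ _ → refl
    ; new     = λ i v∈i → inj₁ (i , v∈i)
    ; vertex  = λ iv → t , All.lookup S⊆t (all∈S iv)
    ; edge    = λ iv v∉S _ → contradiction (all∈S iv) v∉S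
    }
  extend (drop S′⊆S keep B) d t S⊆t fresh
    with extend B d t (All.map (All.lookup S⊆t) S′⊆S)
           (λ iv v∉S′ → fresh iv (λ v∈S → v∉S′ (All.lookup keep v∈S iv)))
  ... | x = record
    { result  = result x
    ; old     = old x
    ; old-bag = old-bag x
    ; new     = new x
    ; vertex  = vertex x
    ; edge    = λ iv v∉S → edge x iv (λ v∈S′ → v∉S (All.lookup S′⊆S v∈S′))
    }
  extend {S} {a} {b} (intro v iv v∉S ≤4 nbrs B) d t S⊆t fresh = record
    { result  = result x
    ; old     = old x ∘ suc
    ; old-bag = old-bag x ∘ suc
    ; new     = λ i w∈i → new′ (new x i w∈i)
    ; vertex  = vertex x
    ; edge    = edge′
    }
    where
    d⁺ : Decomp _
    d⁺ = leaf d t (v ∷ S) (s≤s ≤4) (inj₂ (fresh iv v∉S) ∷ All.map inj₁ S⊆t)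

    fresh⁺ : ∀ {w} → Inside a b w → w ∉ v ∷ S → ∀ i → w ∉ bags d⁺ i
    fresh⁺ iw w∉ zero    = w∉
    fresh⁺ iw w∉ (suc i) = fresh iw (w∉ ∘ there) i

    x : Extension d⁺ (v ∷ S) a b
    x = extend B d⁺ zero (All.tabulate (λ p → p)) fresh⁺

    new′ : ∀ {w} → (∃ λ j → w ∈ bags d⁺ j) ⊎ Inside a b w → (∃ λ j → w ∈ bags d j) ⊎ Inside a b w
    new′ (inj₂ iw) = inj₂ iw
    new′ (inj₁ (zero , here refl)) = inj₂ iv
    new′ (inj₁ (zero , there w∈S)) = inj₁ (t , All.lookup S⊆t w∈S)
    new′ (inj₁ (suc j , w∈j)) = inj₁ (j , w∈j)

    v∈ : v ∈ bags (result x) (old x zero)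
    v∈ = old-∈ x zero (here refl)

    edge-v : ∀ {u} → E v u → ∃ λ i → v ∈ bags (result x) i × u ∈ bags (result x) i
    edge-v {u} e with u ∈? (v ∷ S) | nbrs e
    ... | yes u∈ | _        = old x zero , v∈ , old-∈ x zero u∈
    ... | no u∉  | inj₂ u∈S = contradiction (there u∈S) u∉
    -- The neighbour has yet to enter, so the edge is covered from its side.
    ... | no u∉  | inj₁ iu with edge x iu u∉ (E-sym e)
    ...   | i , u∈i , v∈i = i , v∈i , u∈i

    edge′ : ∀ {w u} → Inside a b w → w ∉ S → E w u →
            ∃ λ i → w ∈ bags (result x) i × u ∈ bags (result x) i
    edge′ {w} iw w∉S e with w ≟ v
    ... | yes refl = edge-v e
    ... | no w≢v   = edge x iw (λ { (here w≡v) → w≢v w≡v ; (there w∈S) → w∉S w∈S }) e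
  extend {S} {a} {b} (split c (a<c , c<b) c∈S B₁ B₂) d t S⊆t fresh = record
    { result  = result x₂
    ; old     = old x₂ ∘ old x₁
    ; old-bag = λ i → trans (old-bag x₂ (old x₁ i)) (old-bag x₁ i)
    ; new     = λ i v∈i → new′ (new x₂ i v∈i)
    ; vertex  = vertex′
    ; edge    = edge′
    }
    where
    x₁ : Extension d S a c
    x₁ = extend B₁ d t S⊆t (λ (a<v , v<c) → fresh (a<v , <-trans v<c c<b))

    -- The first half added only vertices left of `c`, so those right of `c` are still new.
    fresh₂ : ∀ {v} → Inside c b v → v ∉ S → ∀ i → v ∉ bags (result x₁) i
    fresh₂ (c<v , v<b) v∉S i v∈i with new x₁ i v∈i
    ... | inj₁ (j , v∈j) = fresh (<-trans a<c c<v , v<b) v∉S j v∈j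
    ... | inj₂ (_ , v<c) = <-asym c<v v<c

    x₂ : Extension (result x₁) S c b
    x₂ = extend B₂ (result x₁) (old x₁ t) (All.map (old-∈ x₁ t) S⊆t) fresh₂

    new₁ : ∀ {v} → (∃ λ j → v ∈ bags d j) ⊎ Inside a c v → (∃ λ j → v ∈ bags d j) ⊎ Inside a b v
    new₁ (inj₁ p) = inj₁ p
    new₁ (inj₂ (a<v , v<c)) = inj₂ (a<v , <-trans v<c c<b)

    new′ : ∀ {v} → (∃ λ j → v ∈ bags (result x₁) j) ⊎ Inside c b v →
           (∃ λ j → v ∈ bags d j) ⊎ Inside a b v
    new′ (inj₁ (j , v∈j)) = new₁ (new x₁ j v∈j)
    new′ (inj₂ (c<v , v<b)) = inj₂ (<-trans a<c c<v , v<b)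

    vertex′ : ∀ {v} → Inside a b v → ∃ λ i → v ∈ bags (result x₂) i
    vertex′ {v} (a<v , v<b) with <-cmp v c
    ... | tri> _ _ c<v = vertex x₂ (c<v , v<b)
    ... | tri≈ _ refl _ = old x₂ (old x₁ t) , old-∈ x₂ _ (old-∈ x₁ t (All.lookup S⊆t c∈S))
    ... | tri< v<c _ _ with vertex x₁ (a<v , v<c)
    ...   | i , v∈i = old x₂ i , old-∈ x₂ i v∈i

    edge′ : ∀ {v u} → Inside a b v → v ∉ S → E v u →
            ∃ λ i → v ∈ bags (result x₂) i × u ∈ bags (result x₂) i
    edge′ {v} (a<v , v<b) v∉S e with <-cmp v c
    ... | tri> _ _ c<v = edge x₂ (c<v , v<b) v∉S e
    ... | tri≈ _ refl _ = contradiction c∈S v∉S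
    ... | tri< v<c _ _ with edge x₁ (a<v , v<c) v∉S e
    ...   | i , v∈i , u∈i = old x₂ i , old-∈ x₂ i v∈i , old-∈ x₂ i u∈i

-- Crossing counts

module _ {A : Set} (f : A → ℕ) where

  sum-remove : ∀ {x xs} → x ∈ xs →
               ∃ λ xs′ → sum (map f xs) ≡ f x + sum (map f xs′) × (∀ {y} → y ∈ xs → x ≢ y → y ∈ xs′)
  sum-remove {xs = _ ∷ xs} (here refl) = xs , refl , λ
    { (here refl) x≢x → contradiction refl x≢x
    ; (there y∈xs) _  → y∈xs }
  sum-remove {x} {z ∷ xs} (there x∈xs) with sum-remove x∈xs
  ... | xs′ , eq , keep = z ∷ xs′ , shuffle , λ
    { (here y≡z) _      → here y≡z
    ; (there y∈xs) x≢y → there (keep y∈xs x≢y) }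
    where
    open ≡-Reasoning
    shuffle : f z + sum (map f xs) ≡ f x + (f z + sum (map f xs′))
    shuffle = begin
      f z + sum (map f xs)           ≡⟨ cong (f z +_) eq ⟩
      f z + (f x + sum (map f xs′))  ≡⟨ +-assoc (f z) (f x) _ ⟨
      f z + f x + sum (map f xs′)    ≡⟨ cong (_+ sum (map f xs′)) (+-comm (f z) (f x)) ⟩
      f x + f z + sum (map f xs′)    ≡⟨ +-assoc (f x) (f z) _ ⟩
      f x + (f z + sum (map f xs′))  ∎

  -- Without repetitions in `ys`, each of its members can use up its own occurrence in `xs`.
  sum-⊆ : ∀ {xs ys} → Unique ys → All (_∈ xs) ys → sum (map f ys) ≤ sum (map f xs)
  sum-⊆ [] [] = z≤n
  sum-⊆ (y≢ ∷ u) (y∈ ∷ ys∈) with sum-remove y∈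
  ... | xs′ , eq , keep =
    ≤-trans (+-monoʳ-≤ _ (sum-⊆ u (All.zipWith (λ (z∈ , y≢z) → keep z∈ y≢z) (ys∈ , y≢))))
            (≤-reflexive (sym eq))

sum-cartesianProduct : ∀ {A B : Set} (f : A → B → ℕ) xs ys →
  sum (map (λ x → sum (map (f x) ys)) xs) ≡ sum (map (uncurry f) (cartesianProduct xs ys))
sum-cartesianProduct f [] ys = refl
sum-cartesianProduct f (x ∷ xs) ys = begin
  sum (map (f x) ys) + sum (map (λ x → sum (map (f x) ys)) xs)
    ≡⟨ cong₂ _+_ (cong sum (map-∘ ys)) (sum-cartesianProduct f xs ys) ⟩
  sum (map (uncurry f) (map (x ,_) ys)) + sum (map (uncurry f) (cartesianProduct xs ys))
    ≡⟨ sum-++ (map (uncurry f) (map (x ,_) ys)) _ ⟨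
  sum (map (uncurry f) (map (x ,_) ys) ++ map (uncurry f) (cartesianProduct xs ys))
    ≡⟨ cong sum (map-++ (uncurry f) (map (x ,_) ys) _) ⟨
  sum (map (uncurry f) (map (x ,_) ys ++ cartesianProduct xs ys)) ∎
  where open ≡-Reasoning

T⇒≡ : ∀ {b} → T b → b ≡ true
T⇒≡ = Equivalence.to Bool.T-≡

¬T⇒≡ : ∀ {b} → ¬ T b → b ≡ false
¬T⇒≡ {false} _ = refl
¬T⇒≡ {true} ¬t = contradiction tt ¬t

distinct-true : ∀ {i j} → i ≢ j → not (i ≡ᵇ j) ≡ true
distinct-true {i} {j} i≢j = cong not (¬T⇒≡ (i≢j ∘ ≡ᵇ⇒≡ i j))

-- The test `between` on bare positions, to which the test of a drawing unfolds.
betweenℕ : ℕ → ℕ → ℕ → Bool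
betweenℕ i j k = ((i ⊓ j) <ᵇ k) ∧ (k <ᵇ (i ⊔ j))

between-true : ∀ {i j k} → Inside i j k ⊎ Inside j i k → betweenℕ i j k ≡ true
between-true {i} {j} {k} in-k = T⇒≡ (Equivalence.from Bool.T-∧ (bounds in-k))
  where
  bounds : Inside i j k ⊎ Inside j i k → T ((i ⊓ j) <ᵇ k) × T (k <ᵇ (i ⊔ j))
  bounds (inj₁ (i<k , k<j)) =
    <⇒<ᵇ (≤-<-trans (m⊓n≤m i j) i<k) , <⇒<ᵇ (<-≤-trans k<j (m≤n⊔m i j))
  bounds (inj₂ (j<k , k<i)) =
    <⇒<ᵇ (≤-<-trans (m⊓n≤n i j) j<k) , <⇒<ᵇ (<-≤-trans k<i (m≤m⊔n i j))

between-false : ∀ {i j k} → k < i × k < j ⊎ i < k × j < k → betweenℕ i j k ≡ false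
between-false {i} {j} {k} out = ¬T⇒≡ (absurd out ∘ Equivalence.to Bool.T-∧)
  where
  absurd : k < i × k < j ⊎ i < k × j < k → T ((i ⊓ j) <ᵇ k) × T (k <ᵇ (i ⊔ j)) → ⊥
  absurd (inj₁ (k<i , k<j)) (t , _) = <-asym (<ᵇ⇒< (i ⊓ j) k t) (⊓-pres-m< k<i k<j)
  absurd (inj₂ (i<k , j<k)) (_ , t) = <-asym (<ᵇ⇒< k (i ⊔ j) t) (⊔-pres-<m i<k j<k)

Separates : ℕ → ℕ → ℕ → ℕ → Set
Separates l m i j = Inside l m i × Outside l m j ⊎ Inside l m j × Outside l m i

-- Crossing is symmetric in the two chords: `Separates` looks from `lm` at `i` and `j`, while the
-- drawing looks from `ij` at `l` and `m`.
separates-xor : ∀ {l m i j} → Separates l m i j → betweenℕ i j l xor betweenℕ i j m ≡ true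
separates-xor {l} {m} {i} {j} (inj₁ ((l<i , i<m) , inj₁ j<l))
  rewrite between-true {i} {j} {l} (inj₂ (j<l , l<i))
        | between-false {i} {j} {m} (inj₂ (i<m , <-trans j<l (<-trans l<i i<m))) = refl
separates-xor {l} {m} {i} {j} (inj₁ ((l<i , i<m) , inj₂ m<j))
  rewrite between-false {i} {j} {l} (inj₁ (l<i , <-trans (<-trans l<i i<m) m<j))
        | between-true {i} {j} {m} (inj₁ (i<m , m<j)) = refl
separates-xor {l} {m} {i} {j} (inj₂ ((l<j , j<m) , inj₁ i<l))
  rewrite between-true {i} {j} {l} (inj₁ (i<l , l<j))
        | between-false {i} {j} {m} (inj₂ (<-trans i<l (<-trans l<j j<m) , j<m)) = refl
separates-xor {l} {m} {i} {j} (inj₂ ((l<j , j<m) , inj₂ m<i))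
  rewrite between-false {i} {j} {l} (inj₁ (<-trans (<-trans l<j j<m) m<i , l<j))
        | between-true {i} {j} {m} (inj₂ (j<m , m<i)) = refl

record AllDistinct (i j l m : ℕ) : Set where
  constructor distinct₄
  field
    i≢j : i ≢ j
    i≢l : i ≢ l
    i≢m : i ≢ m
    j≢l : j ≢ l
    j≢m : j ≢ m
    l≢m : l ≢ m

inside-outside-distinct : ∀ {l m i j} → Inside l m i → Outside l m j → AllDistinct i j l m
inside-outside-distinct (l<i , i<m) (inj₁ j<l) = distinct₄
  (>⇒≢ (<-trans j<l l<i)) (>⇒≢ l<i) (<⇒≢ i<m)
  (<⇒≢ j<l) (<⇒≢ (<-trans j<l (<-trans l<i i<m))) (<⇒≢ (<-trans l<i i<m))
inside-outside-distinct (l<i , i<m) (inj₂ m<j) = distinct₄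
  (<⇒≢ (<-trans i<m m<j)) (>⇒≢ l<i) (<⇒≢ i<m)
  (>⇒≢ (<-trans (<-trans l<i i<m) m<j)) (>⇒≢ m<j) (<⇒≢ (<-trans l<i i<m))

separates-distinct : ∀ {l m i j} → Separates l m i j → AllDistinct i j l m
separates-distinct (inj₁ (in-i , out-j)) = inside-outside-distinct in-i out-j
separates-distinct (inj₂ (in-j , out-i)) with inside-outside-distinct in-j out-i
... | distinct₄ j≢i j≢l j≢m i≢l i≢m l≢m = distinct₄ (≢-sym j≢i) i≢l i≢m j≢l j≢m l≢m

crossesℕ : ℕ → ℕ → ℕ → ℕ → Bool
crossesℕ i j k l =
  not (i ≡ᵇ j) ∧ not (i ≡ᵇ k) ∧ not (i ≡ᵇ l) ∧
  not (j ≡ᵇ k) ∧ not (j ≡ᵇ l) ∧ not (k ≡ᵇ l) ∧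
  (betweenℕ i j k xor betweenℕ i j l)

crosses-true : ∀ {i j k l} → AllDistinct i j k l → betweenℕ i j k xor betweenℕ i j l ≡ true →
               crossesℕ i j k l ≡ true
crosses-true (distinct₄ a b c d e f) x
  rewrite distinct-true a | distinct-true b | distinct-true c
        | distinct-true d | distinct-true e | distinct-true f = x

separates-crosses : ∀ {l m i j} → Separates l m i j → crossesℕ i j l m ≡ true
separates-crosses s = crosses-true (separates-distinct s) (separates-xor s)

separates-crosses′ : ∀ {l m i j} → Separates l m i j → crossesℕ i j m l ≡ true
separates-crosses′ {l} {m} {i} {j} s with separates-distinct s
... | distinct₄ a b c d e f =
  crosses-true (distinct₄ a c b e d (≢-sym f))
    (trans (Bool.xor-comm (betweenℕ i j m) (betweenℕ i j l)) (separates-xor s))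

∣p∪q∣≤∣p∣+∣q∣ : ∀ {n} (p q : Subset n) → ∣ p ∪ q ∣ ≤ ∣ p ∣ + ∣ q ∣
∣p∪q∣≤∣p∣+∣q∣ []          []          = z≤n
∣p∪q∣≤∣p∣+∣q∣ (false ∷ p) (false ∷ q) = ∣p∪q∣≤∣p∣+∣q∣ p q
∣p∪q∣≤∣p∣+∣q∣ (false ∷ p) (true ∷ q)  =
  ≤-trans (s≤s (∣p∪q∣≤∣p∣+∣q∣ p q)) (≤-reflexive (sym (+-suc ∣ p ∣ ∣ q ∣)))
∣p∪q∣≤∣p∣+∣q∣ (true ∷ p)  (y ∷ q)     =
  s≤s (≤-trans (∣p∪q∣≤∣p∣+∣q∣ p q) (+-monoʳ-≤ ∣ p ∣ (∣q∣≤∣y∷q∣ y)))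
  where
  ∣q∣≤∣y∷q∣ : ∀ y → ∣ q ∣ ≤ ∣ y ∷ q ∣
  ∣q∣≤∣y∷q∣ false = ≤-refl
  ∣q∣≤∣y∷q∣ true  = n≤1+n _

map-walk : ∀ {m} {H : SimpleGraph m} {P Q : Fin m → Set} → (∀ {i} → P i → Q i) →
           ∀ {i j} → Walk H P i j → Walk H Q i j
map-walk P⇒Q (here x)     = here (P⇒Q x)
map-walk P⇒Q (step x e w) = step (P⇒Q x) e (map-walk P⇒Q w)

-- Convex drawings as graphs on positions

module Drawn {n} (G : SimpleGraph n) (D : ConvexDrawing n) where

  p : Fin n → ℕ
  p v = toℕ (pos D v)

  p-injective : ∀ {u v} → p u ≡ p v → u ≡ v
  p-injective = pos-inj D ∘ Fin.toℕ-injective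

  E : ℕ → ℕ → Set
  E i j = ∃₂ λ u v → p u ≡ i × p v ≡ j × Edge G u v

  E? : ∀ i j → Dec (E i j)
  E? i j = Fin.any? λ u → Fin.any? λ v → (p u ≟ i) ×-dec (p v ≟ j) ×-dec T? (Adj G u v)

  edge-sym : ∀ {u v} → Edge G u v → Edge G v u
  edge-sym {u} {v} = subst T (SimpleGraph.sym G u v)

  E-sym : ∀ {i j} → E i j → E j i
  E-sym (u , v , pu , pv , e) = v , u , pv , pu , edge-sym {u} {v} e

  E-bound : ∀ {i j} → E i j → i < n
  E-bound (u , _ , refl , _) = Fin.toℕ<n (pos D u)

  E-irrefl : ∀ {i} → ¬ E i i
  E-irrefl (u , v , pu , pv , e) with p-injective (trans pu (sym pv))
  ... | refl = subst T (irrefl G u) e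

  counted : Fin n → Fin n → Fin n → Fin n → Bool
  counted a b c d = (toℕ c <ᵇ toℕ d) ∧ Adj G c d ∧ crossesB D a b c d

  indicator : Fin n → Fin n → Fin n → Fin n → ℕ
  indicator a b c d = if counted a b c d then 1 else 0

  crossCount-⊇ : ∀ {a b cds} → Unique cds → All (λ cd → uncurry (indicator a b) cd ≡ 1) cds →
                 length cds ≤ crossCount G D a b
  crossCount-⊇ {a} {b} {cds} u ones = begin
    length cds                             ≡⟨ count ones ⟩
    sum (map f cds)                        ≤⟨ sum-⊆ f u (All.tabulate λ _ → ∈-pairs) ⟩
    sum (map f (cartesianProduct vs vs))   ≡⟨ sum-cartesianProduct (indicator a b) vs vs ⟨
    crossCount G D a b                     ∎
    where
    open ≤-Reasoning
    vs = allFin n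
    f = uncurry (indicator a b)
    ∈-pairs : ∀ {cd} → cd ∈ cartesianProduct vs vs
    ∈-pairs = ∈-cartesianProduct⁺ (∈-allFin _) (∈-allFin _)
    count : ∀ {xs} → All (λ cd → f cd ≡ 1) xs → length xs ≡ sum (map f xs)
    count [] = refl
    count (e ∷ es) = cong₂ _+_ (sym e) (count es)

  -- Crossings are counted with the ends of an edge ordered by vertex, while `Crosses` orders them
  -- by position, so both orders must be allowed.
  Represents : ℕ × ℕ → Fin n × Fin n → Set
  Represents (l , m) (c , d) = p c ≡ l × p d ≡ m ⊎ p c ≡ m × p d ≡ l

  represents-unique : ∀ {l m l′ m′ cd} → l < m → l′ < m′ → Represents (l , m) cd →
                      Represents (l′ , m′) cd → (l , m) ≡ (l′ , m′)
  represents-unique l<m l′<m′ (inj₁ (refl , refl)) (inj₁ (refl , refl)) = refl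
  represents-unique l<m l′<m′ (inj₁ (refl , refl)) (inj₂ (refl , refl)) =
    contradiction l<m (<-asym l′<m′)
  represents-unique l<m l′<m′ (inj₂ (refl , refl)) (inj₁ (refl , refl)) =
    contradiction l<m (<-asym l′<m′)
  represents-unique l<m l′<m′ (inj₂ (refl , refl)) (inj₂ (refl , refl)) = refl

  counted-edge : ∀ {a b q} → Crosses E (p a) (p b) q →
                 ∃ λ cd → Represents q cd × uncurry (indicator a b) cd ≡ 1
  counted-edge {a} {b} ((u , v , refl , refl , e) , pu<pv , s) with <-cmp (toℕ u) (toℕ v)
  ... | tri≈ _ u≡v _ = contradiction (cong p (Fin.toℕ-injective u≡v)) (<⇒≢ pu<pv)
  ... | tri< u<v _ _ = (u , v) , inj₁ (refl , refl) , one
    where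
    one : indicator a b u v ≡ 1
    one rewrite T⇒≡ (<⇒<ᵇ u<v) | T⇒≡ e | separates-crosses s = refl
  ... | tri> _ _ v<u = (v , u) , inj₂ (refl , refl) , one
    where
    one : indicator a b v u ≡ 1
    one rewrite T⇒≡ (<⇒<ᵇ v<u) | T⇒≡ (edge-sym {u} {v} e) | separates-crosses′ s = refl

  -- Three different crossings would yield three different counted pairs.
  sparse : IsOuterKPlanarDrawing 2 G D → ∀ {v w q₁ q₂ q₃} → E v w →
           Crosses E v w q₁ → Crosses E v w q₂ → Crosses E v w q₃ →
           q₁ ≡ q₂ ⊎ q₁ ≡ q₃ ⊎ q₂ ≡ q₃
  sparse planar {q₁ = q₁} {q₂} {q₃} (a , b , refl , refl , e) x₁ x₂ x₃
    with q₁ ≟² q₂ | q₁ ≟² q₃ | q₂ ≟² q₃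
  ... | yes eq | _ | _ = inj₁ eq
  ... | no _ | yes eq | _ = inj₂ (inj₁ eq)
  ... | no _ | no _ | yes eq = inj₂ (inj₂ eq)
  ... | no ₁≢₂ | no ₁≢₃ | no ₂≢₃
    with counted-edge x₁ | counted-edge x₂ | counted-edge x₃
  ... | cd₁ , r₁ , one₁ | cd₂ , r₂ , one₂ | cd₃ , r₃ , one₃ =
    contradiction (planar a b e) (<⇒≱ (crossCount-⊇
      ((differ x₁ x₂ r₁ r₂ ₁≢₂ ∷ differ x₁ x₃ r₁ r₃ ₁≢₃ ∷ []) ∷ (differ x₂ x₃ r₂ r₃ ₂≢₃ ∷ []) ∷ [] ∷ [])
      (one₁ ∷ one₂ ∷ one₃ ∷ [])))
    where
    differ : ∀ {q r cd ce} → Crosses E (p a) (p b) q → Crosses E (p a) (p b) r →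
             Represents q cd → Represents r ce → q ≢ r → cd ≢ ce
    differ (_ , q< , _) (_ , r< , _) rq rr q≢r refl = q≢r (represents-unique q< r< rq rr)

  -- A position without a vertex, such as the artificial end `n`, contributes the empty set.
  atPosition : ℕ → Subset n
  atPosition s with Fin.any? (λ v → p v ≟ s)
  ... | yes (v , _) = ⁅ v ⁆
  ... | no _        = Subset.⊥

  vertices : List ℕ → Subset n
  vertices []      = Subset.⊥
  vertices (s ∷ S) = atPosition s ∪ vertices S

  ∈-atPosition⁺ : ∀ v → v Subset.∈ atPosition (p v)
  ∈-atPosition⁺ v with Fin.any? (λ u → p u ≟ p v)
  ... | no none = contradiction (v , refl) none
  ... | yes (u , pu≡pv) with p-injective pu≡pv
  ...   | refl = Subset.x∈⁅x⁆ v

  ∈-atPosition⁻ : ∀ {v} s → v Subset.∈ atPosition s → p v ≡ s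
  ∈-atPosition⁻ s v∈ with Fin.any? (λ u → p u ≟ s)
  ... | no _ = contradiction v∈ Subset.∉⊥
  ... | yes (u , pu≡s) = trans (cong p (Subset.x∈⁅y⁆⇒x≡y u v∈)) pu≡s

  ∣atPosition∣ : ∀ s → ∣ atPosition s ∣ ≤ 1
  ∣atPosition∣ s with Fin.any? (λ u → p u ≟ s)
  ... | no _ = ≤-trans (≤-reflexive (Subset.∣⊥∣≡0 n)) z≤n
  ... | yes (u , _) = ≤-reflexive (Subset.∣⁅x⁆∣≡1 u)

  ∈-vertices⁺ : ∀ {v S} → p v ∈ S → v Subset.∈ vertices S
  ∈-vertices⁺ (here refl) = Subset.x∈p∪q⁺ (inj₁ (∈-atPosition⁺ _))
  ∈-vertices⁺ (there v∈) = Subset.x∈p∪q⁺ (inj₂ (∈-vertices⁺ v∈))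

  ∈-vertices⁻ : ∀ {v} S → v Subset.∈ vertices S → p v ∈ S
  ∈-vertices⁻ [] v∈ = contradiction v∈ Subset.∉⊥
  ∈-vertices⁻ (s ∷ S) v∈ with Subset.x∈p∪q⁻ (atPosition s) (vertices S) v∈
  ... | inj₁ v∈s = here (∈-atPosition⁻ s v∈s)
  ... | inj₂ v∈S = there (∈-vertices⁻ S v∈S)

  ∣vertices∣ : ∀ S → ∣ vertices S ∣ ≤ length S
  ∣vertices∣ [] = ≤-reflexive (Subset.∣⊥∣≡0 n)
  ∣vertices∣ (s ∷ S) =
    ≤-trans (∣p∪q∣≤∣p∣+∣q∣ (atPosition s) (vertices S)) (+-mono-≤ (∣atPosition∣ s) (∣vertices∣ S))

  treewidth≤4 : IsOuterKPlanarDrawing 2 G D → TreewidthAtMost 4 G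
  treewidth≤4 planar = record
    { m        = _
    ; tree     = treeOf result
    ; isTree   = treeOf-isTree result
    ; bag      = λ i → vertices (bags result i)
    ; cover-v  = λ v → lift-∃ (cover-v′ v)
    ; cover-e  = λ u v e → lift-∃₂ (cover-e′ u v e)
    ; coherent = λ v i j v∈i v∈j →
        map-walk ∈-vertices⁺ (coherence result (p v) i j (∈-vertices⁻ _ v∈i) (∈-vertices⁻ _ v∈j))
    } , λ i → ≤-trans (∣vertices∣ (bags result i)) (bags-length result i)
    where
    d₀ : Decomp 0
    d₀ = root (0 ∷ n ∷ []) (s≤s (s≤s z≤n))

    extension : Extension E-sym d₀ (0 ∷ n ∷ []) 0 n
    extension = extend E-sym (Sweep.build E E? E-sym (sparse planar) n E-bound) d₀ zero
      (here refl ∷ there (here refl) ∷ []) (λ _ v∉S _ → v∉S)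

    open Extension extension

    lift-∃ : ∀ {v} → (∃ λ i → p v ∈ bags result i) → ∃ λ i → v Subset.∈ vertices (bags result i)
    lift-∃ (i , v∈) = i , ∈-vertices⁺ v∈

    lift-∃₂ : ∀ {u v} → (∃ λ i → p u ∈ bags result i × p v ∈ bags result i) →
              ∃ λ i → u Subset.∈ vertices (bags result i) × v Subset.∈ vertices (bags result i)
    lift-∃₂ (i , u∈ , v∈) = i , ∈-vertices⁺ u∈ , ∈-vertices⁺ v∈

    cover-v′ : ∀ v → ∃ λ i → p v ∈ bags result i
    cover-v′ v with p v | Fin.toℕ<n (pos D v)
    ... | zero  | _   = old zero , old-∈ zero (here refl)
    ... | suc i | i<n = vertex (s≤s z≤n , i<n)

    cover : ∀ {i j} → E i j → 0 < i → ∃ λ k → i ∈ bags result k × j ∈ bags result k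
    cover e 0<i = edge (0<i , i<n) i∉ e
      where
      i<n = E-bound e
      i∉ : _ ∉ 0 ∷ n ∷ []
      i∉ (here i≡0) = <⇒≢ 0<i (sym i≡0)
      i∉ (there (here i≡n)) = <⇒≢ i<n i≡n

    coverE : ∀ {i j} → E i j → ∃ λ k → i ∈ bags result k × j ∈ bags result k
    coverE {suc i} e = cover e (s≤s z≤n)
    coverE {zero} {zero} e = contradiction e E-irrefl
    -- Position 0 is an end of the interval, so its edges are covered from their other ends.
    coverE {zero} {suc j} e with cover (E-sym e) (s≤s z≤n)
    ... | k , j∈ , i∈ = k , i∈ , j∈

    cover-e′ : ∀ u v → Edge G u v → ∃ λ i → p u ∈ bags result i × p v ∈ bags result i
    cover-e′ u v e = coverE (u , v , refl , refl , e)

-- Cliques in tree decompositions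

module Paths {m} (H : SimpleGraph m) where

  open import Data.List.Membership.DecPropositional (Fin._≟_ {m}) using () renaming (_∈?_ to _∈ᶠ?_)

  data Path : Fin m → Fin m → List (Fin m) → Set where
    end  : ∀ {x} → Path x x (x ∷ [])
    cons : ∀ {x y z vs} → Edge H x y → x ∉ vs → Path y z vs → Path x z (x ∷ vs)

  private variable
    P : Fin m → Set
    w x y z : Fin m
    vs : List (Fin m)

  path-suffix : x ∈ vs → Path y z vs → All P vs → ∃ λ us → Path x z us × All P us
  path-suffix (here refl) end           ps       = _ , end , ps
  path-suffix (here refl) π@(cons _ _ _) ps      = _ , π , ps
  path-suffix (there x∈)  (cons _ _ π)  (_ ∷ ps) = path-suffix x∈ π ps

  -- Loop erasure: if `x` recurs on the remaining path, only the part from that occurrence on is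
  -- kept.
  walk⇒path : Walk H P x z → ∃ λ vs → Path x z vs × All P vs
  walk⇒path (here p) = _ , end , p ∷ []
  walk⇒path {x = x} (step p e w) with walk⇒path w
  ... | vs , π , ps with x ∈ᶠ? vs
  ...   | yes x∈ = path-suffix x∈ π ps
  ...   | no x∉  = _ , cons e x∉ π , p ∷ ps

  path⇒walk : Path x z vs → All P vs → Walk H P x z
  path⇒walk end          (p ∷ _)  = here p
  path⇒walk (cons e _ π) (p ∷ ps) = step p e (path⇒walk π ps)

  _++ʷ_ : Walk H P x y → Walk H P y z → Walk H P x z
  here _     ++ʷ w′ = w′
  step p e w ++ʷ w′ = step p e (w ++ʷ w′)

  path-linked : Edge H w x → Path x z vs → Linked (Edge H) (w ∷ vs)
  path-linked e end           = e ∷ [-]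
  path-linked e (cons e′ _ π) = e ∷ path-linked e′ π

  path-unique : Path x z vs → Unique vs
  path-unique end           = [] ∷ []
  path-unique (cons _ x∉ π) = ¬Any⇒All¬ _ x∉ ∷ path-unique π

  path-last : Path x z vs → ∃ λ zs → vs ≡ zs ∷ʳ z × (x ≢ z → 1 ≤ length zs)
  path-last end = [] , refl , λ x≢x → contradiction refl x≢x
  path-last (cons _ _ π) with path-last π
  ... | zs , refl , _ = _ ∷ zs , refl , λ _ → s≤s z≤n

  close-path : Path x z vs → x ≢ z → All (w ≢_) vs → Edge H w x → Edge H z w → HasCycle H
  close-path {z = z} {w = w} π x≢z w≢ wx zw with path-last π
  ... | zs , refl , ≥1 = w , zs , z , ≥1 x≢z , w≢ ∷ path-unique π , path-linked wx π , zw

  walk-target : Walk H P x z → P z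
  walk-target (here p)     = p
  walk-target (step _ _ w) = walk-target w

  walk-source : Walk H P x z → P x
  walk-source (here p)     = p
  walk-source (step p _ _) = p

  -- The walk is cut at its first arrival in `w`.
  penultimate : ∀ {s} → P s → Walk H P s w → s ≢ w → ∃ λ z → Walk H (w ≢_) s z × P z × Edge H z w
  penultimate p (here _) s≢w = contradiction refl s≢w
  penultimate {w = w} {s} p (step {y = y} _ e π) s≢w with y Fin.≟ w | π
  ... | yes refl | _  = s , here (≢-sym s≢w) , p , e
  ... | no y≢w   | π′ with penultimate (walk-source π′) π′ y≢w
  ...   | z , π″ , q , zw = z , step (≢-sym s≢w) e π″ , q , zw

  -- Every edge of a forest is a bridge. The vertex `z` before the first arrival in `w` is not `u`,
  -- so a path from `u` to `z` avoiding `w` closes up through `w` to a cycle.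
  bridge : ¬ HasCycle H → ∀ {s u} → Edge H w u → Walk H (w ≢_) u s → Walk H (u ≢_) s w → ⊥
  bridge acyclic {s} {u} wu from-u to-w
    with penultimate (walk-source to-w) to-w (≢-sym (walk-target from-u))
  ... | z , s⇝z , u≢z , zw with walk⇒path (from-u ++ʷ s⇝z)
  ...   | vs , π , avoids = acyclic (close-path π u≢z avoids wu zw)

Complete : ∀ {n} → SimpleGraph n → Set
Complete G = ∀ u v → u ≢ v → Edge G u v

module CliqueBag {n} {G : SimpleGraph n} (complete : Complete G) (TD : TreeDecomposition G) where

  open Paths (tree TD)

  Below : ℕ → Fin (m TD) → Set
  Below k t = ∀ v → toℕ v < k → v Subset.∈ bag TD t

  below? : ∀ k t → Dec (Below k t)
  below? k t = Fin.all? λ v → (toℕ v <? k) →-dec (v Subset.∈? bag TD t)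

  -- Leaving the nodes whose bags contain the first k vertices would lose some vertex i, but the
  -- bags with i and those with v meet in a bag covering the edge iv, which closes a cycle.
  along : ∀ {k t t′ vs} v → toℕ v ≡ k → Path t t′ vs → Below k t → v Subset.∈ bag TD t′ →
          ∃ λ s → Below k s × v Subset.∈ bag TD s
  along {k} {t} v v≡k π below v∈t′ with v Subset.∈? bag TD t
  ... | yes v∈t = t , below , v∈t
  along v v≡k end below v∈t′ | no v∉t = contradiction v∈t′ v∉t
  along {k} {t} {t′} v v≡k (cons {y = u} tu t∉ π) below v∈t′ | no v∉t with below? k u
  ... | yes below-u = along v v≡k π below-u v∈t′
  ... | no ¬below-u with Fin.¬∀⟶∃¬ n _ (λ i → (toℕ i <? k) →-dec (i Subset.∈? bag TD u)) ¬below-u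
  ...   | i , ¬below-i = ⊥-elim (bridge (proj₂ (proj₂ (isTree TD))) tu u⇝s s⇝t)
    where
    i<k : toℕ i < k
    i<k with toℕ i <? k
    ... | yes i<k = i<k
    ... | no i≮k  = contradiction (λ i<k → contradiction i<k i≮k) ¬below-i

    i∉u : i Subset.∉ bag TD u
    i∉u i∈u = ¬below-i λ _ → i∈u

    i≢v : i ≢ v
    i≢v refl = <-irrefl v≡k i<k

    common = cover-e TD i v (complete i v i≢v)
    s = proj₁ common

    -- The remaining path never returns to `t`, and `t` is not among the nodes whose bags contain
    -- `v`.
    u⇝s : Walk (tree TD) (t ≢_) u s
    u⇝s = path⇒walk π (¬Any⇒All¬ _ t∉) ++ʷ
          map-walk (λ { v∈t refl → v∉t v∈t }) (coherent TD v t′ s v∈t′ (proj₂ (proj₂ common)))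

    s⇝t : Walk (tree TD) (u ≢_) s t
    s⇝t = map-walk (λ { i∈u refl → i∉u i∈u })
            (coherent TD i s t (proj₁ (proj₂ common)) (below i i<k))

  -- In place of the Helly property of subtrees, vertices are gathered one by one: the tree path
  -- towards a bag with the next vertex meets a bag that holds it along with all earlier ones.
  prefix-bag : ∀ k → k ≤ n → ∃ (Below k)
  prefix-bag zero _ = fromℕ< (proj₁ (isTree TD)) , λ _ ()
  prefix-bag (suc k) k<n with prefix-bag k (<⇒≤ k<n) | cover-v TD (fromℕ< k<n)
  ... | t , below | t′ , v∈t′ with walk⇒path (proj₁ (proj₂ (isTree TD)) t t′)
  ...   | _ , π , _ with along (fromℕ< k<n) (Fin.toℕ-fromℕ< k<n) π below v∈t′
  ...     | s , below-s , v∈s = s , below⁺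
    where
    below⁺ : Below (suc k) s
    below⁺ w w<1+k with m<1+n⇒m<n∨m≡n w<1+k
    ... | inj₁ w<k = below-s w w<k
    ... | inj₂ w≡k =
      subst (Subset._∈ bag TD s) (Fin.toℕ-injective (trans (Fin.toℕ-fromℕ< k<n) (sym w≡k))) v∈s

  full-bag : ∃ λ t → n ≤ ∣ bag TD t ∣
  full-bag with prefix-bag n ≤-refl
  ... | t , all∈ = t , ≤-trans (≤-reflexive (sym (Subset.∣⊤∣≡n n)))
                        (Subset.p⊆q⇒∣p∣≤∣q∣ {p = Subset.⊤} λ {v} _ → all∈ v (Fin.toℕ<n v))

-- Tightness for the complete graph on five vertices

K₅ : SimpleGraph 5
K₅ = record
  { Adj    = adj
  ; sym    = from-yes (Fin.all? λ x → Fin.all? λ y → adj x y Bool.≟ adj y x)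
  ; irrefl = from-yes (Fin.all? λ x → adj x x Bool.≟ false)
  }
  where
  adj : Fin 5 → Fin 5 → Bool
  adj x y = not (toℕ x ≡ᵇ toℕ y)

K₅-complete : Complete K₅
K₅-complete u v u≢v = subst T (sym (distinct-true (u≢v ∘ Fin.toℕ-injective))) _

-- Sides of the pentagon are not crossed and each diagonal meets two others, which is decided by
-- evaluation.
K₅-outer-2-planar : OuterKPlanar 2 K₅
K₅-outer-2-planar = pentagon , from-yes
  (Fin.all? λ a → Fin.all? λ b → T? (Adj K₅ a b) →-dec (crossCount K₅ pentagon a b ≤? 2))
  where
  pentagon : ConvexDrawing 5
  pentagon = record { pos = id ; pos-inj = id }

-- A bag with all `n` vertices exceeds the `j + 1` that width `j` allows.
complete-treewidth-≥ : ∀ {n j} {G : SimpleGraph n} → Complete G → suc j < n → ¬ TreewidthAtMost j G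
complete-treewidth-≥ complete 1+j<n (TD , narrow) with CliqueBag.full-bag complete TD
... | t , n≤ = <⇒≱ 1+j<n (≤-trans n≤ (narrow t))

theorem12 : ((n : ℕ) (G : SimpleGraph n) → OuterKPlanar 2 G → TreewidthAtMost 4 G)
    × Σ ℕ (λ n → Σ (SimpleGraph n) (λ G → OuterKPlanar 2 G × TreewidthExactly 4 G))
theorem12 = upper , 5 , K₅ , K₅-outer-2-planar , upper 5 K₅ K₅-outer-2-planar ,
            λ j j<4 → complete-treewidth-≥ K₅-complete (s≤s j<4)
  where
  upper : (n : ℕ) (G : SimpleGraph n) → OuterKPlanar 2 G → TreewidthAtMost 4 G
  upper n G (D , planar) = Drawn.treewidth≤4 G D planar
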